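{- For every odd prime $p$, the quantity $r_3((\mathbb{Z}/p\mathbb{Z})^n)^{1/n}$ is bounded away from $p$ as $n$ grows; that is, there exist a real number $c < p$ (depending only on $p$) and an integer $n_0$ such that $r_3((\mathbb{Z}/p\mathbb{Z})^n)^{1/n} \leq c$ for all integers $n \geq n_0$.
   Context: For a finite abelian group $G$, $r_3(G)$ denotes the maximal size of a subset of $G$ containing no three-term arithmetic progression. A three-term arithmetic progression means a nontrivial one: elements $a,\ a+h,\ a+2h$ of $G$ with $h \neq 0$. -}

module Defs where

open import Algebra.Bundles using (AbelianGroup)
import Algebra.Construct.Pointwise as Pointwise
import Algebra.Definitions.RawSemiring as RawSemiringDefinitions
open import Data.Bool.Base using (true; false)
open import Data.Fin.Base as Fin using (Fin; toℕ; fromℕ<; finToFun; funToFin)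
import Data.Fin.Properties as Fin
open import Data.Fin.Subset using (Subset; ∣_∣; inside; outside) renaming (_∈_ to _∈ˢ_; ⊥ to ∅)
import Data.Fin.Subset.Properties as Subset
open import Data.Integer.Base as ℤ using (ℤ; +_)
import Data.Integer.DivMod as ℤ
open import Data.Integer.Divisibility.Signed as ℤ∣ using (divides)
import Data.Integer.Properties as ℤ
open import Data.Integer.Tactic.RingSolver using (solve-∀)
open import Data.List.Base using (List; []; _∷_; _++_; map; filter)
open import Data.List.Extrema.Nat using (max; xs≤max; argmax-all)
open import Data.List.Membership.Propositional using (_∈_)
import Data.List.Membership.Propositional.Properties as List
open import Data.List.Relation.Unary.All as All using (All)
open import Data.List.Relation.Unary.Any using (here)
open import Data.Nat.Base as ℕ using (ℕ; zero; suc)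
import Data.Nat.DivMod as ℕ
import Data.Nat.Divisibility as ℕ
import Data.Nat.Properties as ℕ
open import Data.Product.Base using (∃; ∃₂; _×_; _,_; proj₂)
open import Data.Rational.Base as ℚ using (ℚ; 0ℚ; 1ℚ)
import Data.Rational.Properties as ℚ
open import Data.Sum.Base using (_⊎_; inj₁; inj₂)
open import Data.Vec.Base using ([]; _∷_)
open import Function.Base using (_∘_; id)
open import Function.Bundles using (Inverse)
open import Level using (0ℓ; _⊔_) renaming (suc to lsuc)
open import Relation.Binary.PropositionalEquality as ≡ using (_≡_; refl; cong; cong₂; sym; trans; subst)
open import Relation.Nullary using (¬_; Dec; yes; no; ¬?; contradiction; _×-dec_)
import Relation.Nullary.Decidable as Dec

record FiniteAbelianGroup c ℓ : Set (lsuc (c ⊔ ℓ)) where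
  field
    abelianGroup : AbelianGroup c ℓ

  open AbelianGroup abelianGroup public
    renaming (_∙_ to _+_; ε to 0#; _⁻¹ to -_; ∙-cong to +-cong)

  field
    order       : ℕ
    enumeration : Inverse setoid (≡.setoid (Fin order))

  open Inverse enumeration public
    using ()
    renaming (to to index; from to element; to-cong to index-cong; from-cong to element-cong)

  index-element : ∀ i → index (element i) ≡ i
  index-element = Inverse.strictlyInverseˡ enumeration

  element-index : ∀ a → element (index a) ≈ a
  element-index = Inverse.strictlyInverseʳ enumeration

module _ {c ℓ} (G : FiniteAbelianGroup c ℓ) where
  open FiniteAbelianGroup G renaming (refl to ≈-refl; sym to ≈-sym; trans to ≈-trans)

  -- Subsets of G are represented as subsets of its set of indices; in this
  -- way they automatically respect the equality _≈_ of G.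
  GSubset : Set
  GSubset = Subset order

  infix 4 _∈ᴳ_
  _∈ᴳ_ : Carrier → GSubset → Set
  a ∈ᴳ S = index a ∈ˢ S

  HasThreeAP : GSubset → Set (c ⊔ ℓ)
  HasThreeAP S = ∃₂ λ a h → ¬ (h ≈ 0#) × a ∈ᴳ S × (a + h) ∈ᴳ S × (a + (h + h)) ∈ᴳ S

  APFree : GSubset → Set (c ⊔ ℓ)
  APFree S = ¬ HasThreeAP S

  private
    ∈ᴳ-resp : ∀ {S a b} → a ≈ b → a ∈ᴳ S → b ∈ᴳ S
    ∈ᴳ-resp {S} a≈b = subst (_∈ˢ S) (index-cong a≈b)

    _≈?_ : ∀ a b → Dec (a ≈ b)
    a ≈? b = Dec.map′
      (λ eq → ≈-trans (≈-sym (element-index a)) (≈-trans (element-cong eq) (element-index b)))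
      index-cong
      (index a Fin.≟ index b)

  hasThreeAP? : ∀ S → Dec (HasThreeAP S)
  hasThreeAP? S = Dec.map′
    (λ (i , j , ap) → element i , element j , ap)
    (λ (a , h , h≉0 , p , q , r) →
      let a≈ = ≈-sym (element-index a)
          h≈ = ≈-sym (element-index h)
      in index a , index h
       , (λ eq → h≉0 (≈-trans h≈ eq))
       , ∈ᴳ-resp a≈ p
       , ∈ᴳ-resp (+-cong a≈ h≈) q
       , ∈ᴳ-resp (+-cong a≈ (+-cong h≈ h≈)) r)
    (Fin.any? λ i → Fin.any? λ j → let a = element i; h = element j in
      ¬? (h ≈? 0#)
        ×-dec (index a Subset.∈? S)
        ×-dec (index (a + h) Subset.∈? S)
        ×-dec (index (a + (h + h)) Subset.∈? S))

  apFree? : ∀ S → Dec (APFree S)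
  apFree? S = ¬? (hasThreeAP? S)

allSubsets : ∀ n → List (Subset n)
allSubsets zero    = [] ∷ []
allSubsets (suc n) = map (inside ∷_) (allSubsets n) ++ map (outside ∷_) (allSubsets n)

∈-allSubsets : ∀ {n} (S : Subset n) → S ∈ allSubsets n
∈-allSubsets []          = here refl
∈-allSubsets (true  ∷ S) = List.∈-++⁺ˡ (List.∈-map⁺ _ (∈-allSubsets S))
∈-allSubsets (false ∷ S) = List.∈-++⁺ʳ _ (List.∈-map⁺ _ (∈-allSubsets S))

r₃ : ∀ {c ℓ} → FiniteAbelianGroup c ℓ → ℕ
r₃ G = max 0 (map ∣_∣ (filter (apFree? G) (allSubsets order)))
  where open FiniteAbelianGroup G

module _ {c ℓ} (G : FiniteAbelianGroup c ℓ) where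

  r₃-upper : ∀ S → APFree G S → ∣ S ∣ ℕ.≤ r₃ G
  r₃-upper S free = All.lookup (xs≤max 0 _)
    (List.∈-map⁺ ∣_∣ (List.∈-filter⁺ (apFree? G) (∈-allSubsets S) free))

  r₃-attained : ∃ λ S → APFree G S × ∣ S ∣ ≡ r₃ G
  r₃-attained = argmax-all id {P = λ m → ∃ λ S → APFree G S × ∣ S ∣ ≡ m}
    (∅ , (λ (_ , _ , _ , a∈∅ , _) → Subset.∉⊥ a∈∅) , Subset.∣⊥∣≡0 (FiniteAbelianGroup.order G))
    (All.tabulate λ m∈ → let (S , S∈ , m≡) = List.∈-map⁻ ∣_∣ m∈ in
      S , proj₂ (List.∈-filter⁻ (apFree? G) {xs = allSubsets _} S∈) , sym m≡)

-- ℤ/mℤ is the quotient setoid of ℤ by congruence modulo m.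
module _ (m : ℕ) where

  infix 4 _≡ₘ_
  _≡ₘ_ : ℤ → ℤ → Set
  a ≡ₘ b = (+ m) ℤ∣.∣ (a ℤ.- b)

  private
    resp : ∀ {x y} → x ≡ y → (+ m) ℤ∣.∣ x → (+ m) ℤ∣.∣ y
    resp = subst ((+ m) ℤ∣.∣_)

  ≡⇒≡ₘ : ∀ {a b} → a ≡ b → a ≡ₘ b
  ≡⇒≡ₘ {a} refl = divides (+ 0) (ℤ.i≡j⇒i-j≡0 {a} refl)

  ≡ₘ-sym : ∀ {a b} → a ≡ₘ b → b ≡ₘ a
  ≡ₘ-sym {a} {b} p = resp (eq a b) (ℤ∣.∣m⇒∣-m p)
    where
    eq : ∀ a b → ℤ.- (a ℤ.- b) ≡ b ℤ.- a
    eq = solve-∀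

  ≡ₘ-trans : ∀ {a b c} → a ≡ₘ b → b ≡ₘ c → a ≡ₘ c
  ≡ₘ-trans {a} {b} {c} p q = resp (eq a b c) (ℤ∣.∣m∣n⇒∣m+n p q)
    where
    eq : ∀ a b c → (a ℤ.- b) ℤ.+ (b ℤ.- c) ≡ a ℤ.- c
    eq = solve-∀

  ≡ₘ-+-cong : ∀ {a b c d} → a ≡ₘ b → c ≡ₘ d → (a ℤ.+ c) ≡ₘ (b ℤ.+ d)
  ≡ₘ-+-cong {a} {b} {c} {d} p q = resp (eq a b c d) (ℤ∣.∣m∣n⇒∣m+n p q)
    where
    eq : ∀ a b c d → (a ℤ.- b) ℤ.+ (c ℤ.- d) ≡ (a ℤ.+ c) ℤ.- (b ℤ.+ d)
    eq = solve-∀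

  ≡ₘ-neg-cong : ∀ {a b} → a ≡ₘ b → (ℤ.- a) ≡ₘ (ℤ.- b)
  ≡ₘ-neg-cong {a} {b} p = resp (eq a b) (ℤ∣.∣m⇒∣-m p)
    where
    eq : ∀ a b → ℤ.- (a ℤ.- b) ≡ (ℤ.- a) ℤ.- (ℤ.- b)
    eq = solve-∀

  ℤ/-abelianGroup : AbelianGroup 0ℓ 0ℓ
  ℤ/-abelianGroup = record
    { Carrier = ℤ
    ; _≈_     = _≡ₘ_
    ; _∙_     = ℤ._+_
    ; ε       = + 0
    ; _⁻¹     = ℤ.-_
    ; isAbelianGroup = record
      { isGroup = record
        { isMonoid = record
          { isSemigroup = record
            { isMagma = record
              { isEquivalence = record
                { refl  = λ {a} → ≡⇒≡ₘ {a} refl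
                ; sym   = λ {a b} → ≡ₘ-sym {a} {b}
                ; trans = λ {a b c} → ≡ₘ-trans {a} {b} {c}
                }
              ; ∙-cong = λ {a b c d} → ≡ₘ-+-cong {a} {b} {c} {d}
              }
            ; assoc = λ a b c → ≡⇒≡ₘ (ℤ.+-assoc a b c)
            }
          ; identity = (λ a → ≡⇒≡ₘ (ℤ.+-identityˡ a)) , (λ a → ≡⇒≡ₘ (ℤ.+-identityʳ a))
          }
        ; inverse = (λ a → ≡⇒≡ₘ (ℤ.+-inverseˡ a)) , (λ a → ≡⇒≡ₘ (ℤ.+-inverseʳ a))
        ; ⁻¹-cong = λ {a b} → ≡ₘ-neg-cong {a} {b}
        }
      ; comm = λ a b → ≡⇒≡ₘ (ℤ.+-comm a b)
      }
    }

  module _ .{{_ : ℕ.NonZero m}} where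

    residue : ℤ → Fin m
    residue a = fromℕ< (ℤ.n%ℕd<d a m)

    representative : Fin m → ℤ
    representative i = + toℕ i

    representative-residue : ∀ a → representative (residue a) ≡ₘ a
    representative-residue a = ≡ₘ-sym {a} {representative (residue a)} (divides (a ℤ./ℕ m) eq)
      where
      lem : ∀ r q → (r ℤ.+ q) ℤ.- r ≡ q
      lem = solve-∀
      eq : a ℤ.- representative (residue a) ≡ (a ℤ./ℕ m) ℤ.* + m
      eq = trans
        (cong₂ ℤ._-_ (ℤ.a≡a%ℕn+[a/ℕn]*n a m) (cong +_ (Fin.toℕ-fromℕ< (ℤ.n%ℕd<d a m))))
        (lem (+ (a ℤ.%ℕ m)) ((a ℤ./ℕ m) ℤ.* + m))

    representative-injective : ∀ i j → representative i ≡ₘ representative j → i ≡ j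
    representative-injective i j i≡j = Fin.toℕ-injective (ℤ.+-injective
      (ℤ.i-j≡0⇒i≡j _ _ (ℤ.∣i∣≡0⇒i≡0 (small _ bound (ℤ∣.∣⇒∣ᵤ i≡j)))))
      where
      bound : ℤ.∣ + toℕ i ℤ.- + toℕ j ∣ ℕ.< m
      bound = ℕ.≤-<-trans
        (subst (λ z → ℤ.∣ z ∣ ℕ.≤ toℕ i ℕ.⊔ toℕ j) (sym (ℤ.m-n≡m⊖n (toℕ i) (toℕ j)))
          (ℤ.∣m⊝n∣≤m⊔n (toℕ i) (toℕ j)))
        (ℕ.⊔-lub (Fin.toℕ<n i) (Fin.toℕ<n j))
      small : ∀ k → k ℕ.< m → m ℕ.∣ k → k ≡ 0
      small zero    _   _   = refl
      small (suc k) k<m m∣k = contradiction (ℕ.∣⇒≤ m∣k) (ℕ.<⇒≱ k<m)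

    residue-cong : ∀ {a b} → a ≡ₘ b → residue a ≡ residue b
    residue-cong {a} {b} a≡b = representative-injective _ _
      (≡ₘ-trans {representative (residue a)} {a} (representative-residue a)
        (≡ₘ-trans {a} {b} a≡b
          (≡ₘ-sym {representative (residue b)} {b} (representative-residue b))))

    residue-representative : ∀ i → residue (representative i) ≡ i
    residue-representative i = representative-injective _ _ (representative-residue (representative i))

    ℤ/ : FiniteAbelianGroup 0ℓ 0ℓ
    ℤ/ = record
      { abelianGroup = ℤ/-abelianGroup
      ; order        = m
      ; enumeration  = record
        { to        = residue
        ; from      = representative
        ; to-cong   = λ {a b} → residue-cong {a} {b}
        ; from-cong = λ eq → ≡⇒≡ₘ (cong representative eq)
        ; inverse   =
            (λ {i a} a≡i → trans (residue-cong {a} {representative i} a≡i) (residue-representative i))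
          , (λ {a i} i≡ → subst (λ k → representative k ≡ₘ a) (sym i≡) (representative-residue a))
        }
      }

funToFin-cong : ∀ {m n} {f g : Fin m → Fin n} → (∀ i → f i ≡ g i) → funToFin f ≡ funToFin g
funToFin-cong {zero}  eq = refl
funToFin-cong {suc m} eq = cong₂ Fin.combine (eq Fin.zero) (funToFin-cong (eq ∘ Fin.suc))

infixl 8 _^ᴳ_
_^ᴳ_ : ∀ {c ℓ} → FiniteAbelianGroup c ℓ → ℕ → FiniteAbelianGroup c ℓ
G ^ᴳ n = record
  { abelianGroup = Pointwise.abelianGroup (Fin n) G.abelianGroup
  ; order        = G.order ℕ.^ n
  ; enumeration  = record
    { to        = to
    ; from      = from
    ; to-cong   = to-cong
    ; from-cong = from-cong
    ; inverse   =
        (λ {i} f≈ → trans (to-cong f≈) (to-from i))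
      , (λ {f} i≡ k → G.trans (from-cong i≡ k) (from-to f k))
    }
  }
  where
  module G = FiniteAbelianGroup G
  to : (Fin n → G.Carrier) → Fin (G.order ℕ.^ n)
  to f = funToFin (G.index ∘ f)
  from : Fin (G.order ℕ.^ n) → Fin n → G.Carrier
  from i = G.element ∘ finToFun i
  to-cong : ∀ {f g} → (∀ k → f k G.≈ g k) → to f ≡ to g
  to-cong f≈g = funToFin-cong (G.index-cong ∘ f≈g)
  from-cong : ∀ {i j} → i ≡ j → ∀ k → from i k G.≈ from j k
  from-cong refl _ = G.refl
  to-from : ∀ i → to (from i) ≡ i
  to-from i = trans (funToFin-cong (G.index-element ∘ finToFun {G.order} {n} i)) (Fin.funToFin-finToFin {n} {G.order} i)
  from-to : ∀ f k → from (to f) k G.≈ f k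
  from-to f k = G.trans
    (G.element-cong (Fin.finToFun-funToFin (G.index ∘ f) k))
    (G.element-index (f k))

record ℝ : Set₁ where
  field
    lower upper     : ℚ → Set
    lower-inhabited : ∃ lower
    upper-inhabited : ∃ upper
    lower-closed    : ∀ {q r} → q ℚ.< r → lower r → lower q
    upper-closed    : ∀ {q r} → q ℚ.< r → upper q → upper r
    lower-open      : ∀ {q} → lower q → ∃ λ r → q ℚ.< r × lower r
    upper-open      : ∀ {r} → upper r → ∃ λ q → q ℚ.< r × upper q
    disjoint        : ∀ {q} → lower q → ¬ upper q
    located         : ∀ {q r} → q ℚ.< r → lower q ⊎ upper r

open ℝ

infix 4 _≤ℝ_ _<ℝ_

_≤ℝ_ : ℝ → ℝ → Set
x ≤ℝ y = ∀ q → lower x q → lower y q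

_<ℝ_ : ℝ → ℝ → Set
x <ℝ y = ∃ λ q → upper x q × lower y q

private
  0<1 : 0ℚ ℚ.< 1ℚ
  0<1 = ℚ.positive⁻¹ 1ℚ

  q<q+1 : ∀ q → q ℚ.< q ℚ.+ 1ℚ
  q<q+1 q = subst (ℚ._< q ℚ.+ 1ℚ) (ℚ.+-identityʳ q) (ℚ.+-monoʳ-< q 0<1)

  q-1<q : ∀ q → q ℚ.- 1ℚ ℚ.< q
  q-1<q q = subst (q ℚ.- 1ℚ ℚ.<_) (ℚ.+-identityʳ q) (ℚ.+-monoʳ-< q (ℚ.negative⁻¹ (ℚ.- 1ℚ)))

fromℚ : ℚ → ℝ
fromℚ x = record
  { lower           = ℚ._< x
  ; upper           = x ℚ.<_
  ; lower-inhabited = x ℚ.- 1ℚ , q-1<q x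
  ; upper-inhabited = x ℚ.+ 1ℚ , q<q+1 x
  ; lower-closed    = ℚ.<-trans
  ; upper-closed    = λ q<r x<q → ℚ.<-trans x<q q<r
  ; lower-open      = λ q<x → let (r , q<r , r<x) = ℚ.<-dense q<x in r , q<r , r<x
  ; upper-open      = λ x<r → let (q , x<q , q<r) = ℚ.<-dense x<r in q , q<r , x<q
  ; disjoint        = ℚ.<-asym
  ; located         = λ q<r → located′ q<r
  }
  where
  located′ : ∀ {q r} → q ℚ.< r → q ℚ.< x ⊎ x ℚ.< r
  located′ {q} q<r with q ℚ.<? x
  ... | yes q<x = inj₁ q<x
  ... | no  q≮x = inj₂ (ℚ.≤-<-trans (ℚ.≮⇒≥ q≮x) q<r)

ℕ→ℚ : ℕ → ℚ
ℕ→ℚ n = + n ℚ./ 1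

fromℕ : ℕ → ℝ
fromℕ n = fromℚ (ℕ→ℚ n)

open RawSemiringDefinitions ℚ.+-*-rawSemiring public using (_^_)

module _ where
  open ℚ.≤-Reasoning

  ^-nonNeg : ∀ {q} n → 0ℚ ℚ.≤ q → 0ℚ ℚ.≤ q ^ n
  ^-nonNeg         zero    0≤q = ℚ.<⇒≤ 0<1
  ^-nonNeg {q} (suc n) 0≤q = begin
    0ℚ            ≡⟨ ℚ.*-zeroʳ q ⟨
    q ℚ.* 0ℚ      ≤⟨ ℚ.*-monoˡ-≤-nonNeg q {{ℚ.nonNegative 0≤q}} (^-nonNeg n 0≤q) ⟩
    q ℚ.* q ^ n   ∎

  ^-mono-< : ∀ {q r} n .{{_ : ℕ.NonZero n}} → 0ℚ ℚ.≤ q → q ℚ.< r → q ^ n ℚ.< r ^ n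
  ^-mono-< {q} {r} (suc zero) 0≤q q<r = begin-strict
    q ℚ.* 1ℚ   ≡⟨ ℚ.*-identityʳ q ⟩
    q          <⟨ q<r ⟩
    r          ≡⟨ ℚ.*-identityʳ r ⟨
    r ℚ.* 1ℚ   ∎
  ^-mono-< {q} {r} (suc n@(suc _)) 0≤q q<r = begin-strict
    q ℚ.* q ^ n   ≤⟨ ℚ.*-monoʳ-≤-nonNeg (q ^ n) {{ℚ.nonNegative (^-nonNeg n 0≤q)}} (ℚ.<⇒≤ q<r) ⟩
    r ℚ.* q ^ n   <⟨ ℚ.*-monoʳ-<-pos r {{ℚ.positive (ℚ.≤-<-trans 0≤q q<r)}} (^-mono-< n 0≤q q<r) ⟩
    r ℚ.* r ^ n   ∎

  1≤^ : ∀ {q} n → 1ℚ ℚ.≤ q → 1ℚ ℚ.≤ q ^ n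
  ≤^  : ∀ {q} n .{{_ : ℕ.NonZero n}} → 1ℚ ℚ.≤ q → q ℚ.≤ q ^ n

  1≤^ zero    1≤q = ℚ.≤-refl
  1≤^ (suc n) 1≤q = ℚ.≤-trans 1≤q (≤^ (suc n) 1≤q)

  ≤^ {q} (suc n) 1≤q = begin
    q             ≡⟨ ℚ.*-identityʳ q ⟨
    q ℚ.* 1ℚ      ≤⟨ ℚ.*-monoˡ-≤-nonNeg q {{ℚ.nonNegative (ℚ.≤-trans (ℚ.<⇒≤ 0<1) 1≤q)}} (1≤^ n 1≤q) ⟩
    q ℚ.* q ^ n   ∎

  0^≡0 : ∀ n .{{_ : ℕ.NonZero n}} → 0ℚ ^ n ≡ 0ℚ
  0^≡0 (suc n) = ℚ.*-zeroˡ (0ℚ ^ n)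

  0≤ℕ→ℚ : ∀ a → 0ℚ ℚ.≤ ℕ→ℚ a
  0≤ℕ→ℚ a = ℚ.nonNegative⁻¹ (ℕ→ℚ a) {{ℚ.normalize-nonNeg a 1}}

-- The non-negative n-th root of a, given by the cut with
--   lower class  { q | q < s for some rational s ≥ 0 with sⁿ ≤ a },
--   upper class  { q | s < q for some rational s ≥ 0 with a ≤ sⁿ }.
root : ∀ n .{{_ : ℕ.NonZero n}} → ℕ → ℝ
root n a = record
  { lower           = L
  ; upper           = U
  ; lower-inhabited = 0ℚ ℚ.- 1ℚ , 0ℚ , q-1<q 0ℚ , ℚ.≤-refl , 0^n≤a
  ; upper-inhabited =
      let s = a′ ℚ.+ 1ℚ
          1≤s = ℚ.+-monoˡ-≤ 1ℚ (0≤ℕ→ℚ a)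
      in s ℚ.+ 1ℚ , s , q<q+1 s , ℚ.≤-trans (ℚ.<⇒≤ 0<1) 1≤s
       , ℚ.≤-trans (ℚ.<⇒≤ (q<q+1 a′)) (≤^ n 1≤s)
  ; lower-closed    = λ q<r (s , r<s , p) → s , ℚ.<-trans q<r r<s , p
  ; upper-closed    = λ q<r (s , s<q , p) → s , ℚ.<-trans s<q q<r , p
  ; lower-open      = λ (s , q<s , p) →
      let (r , q<r , r<s) = ℚ.<-dense q<s in r , q<r , s , r<s , p
  ; upper-open      = λ (s , s<r , p) →
      let (q , s<q , q<r) = ℚ.<-dense s<r in q , q<r , s , s<q , p
  ; disjoint        = λ (s , q<s , _ , sⁿ≤a) (t , t<q , 0≤t , a≤tⁿ) →
      ℚ.<-irrefl refl (ℚ.<-≤-trans (^-mono-< n 0≤t (ℚ.<-trans t<q q<s)) (ℚ.≤-trans sⁿ≤a a≤tⁿ))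
  ; located         = located′
  }
  where
  a′ = ℕ→ℚ a
  L U : ℚ → Set
  L q = ∃ λ s → q ℚ.< s × 0ℚ ℚ.≤ s × s ^ n ℚ.≤ a′
  U q = ∃ λ s → s ℚ.< q × 0ℚ ℚ.≤ s × a′ ℚ.≤ s ^ n
  0^n≤a : 0ℚ ^ n ℚ.≤ a′
  0^n≤a = subst (ℚ._≤ a′) (sym (0^≡0 n)) (0≤ℕ→ℚ a)
  located′ : ∀ {q r} → q ℚ.< r → L q ⊎ U r
  located′ {q} {r} q<r with ℚ.<-dense q<r
  ... | m , q<m , m<r with 0ℚ ℚ.≤? m | m ^ n ℚ.≤? a′
  ...   | no  0≰m | _       = inj₁ (0ℚ , ℚ.<-trans q<m (ℚ.≰⇒> 0≰m) , ℚ.≤-refl , 0^n≤a)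
  ...   | yes 0≤m | yes m≤a = inj₁ (m , q<m , 0≤m , m≤a)
  ...   | yes 0≤m | no  m≰a = inj₂ (m , m<r , 0≤m , ℚ.<⇒≤ (ℚ.≰⇒> m≰a))

{-# OPTIONS --safe #-}

-- Let A ⊆ 𝔽ₚⁿ be free of progressions and d = p - 1. The polynomial T(x,y,z) = ∏ₖ ∏_{1≤j≤d} (xₖ - 2yₖ + zₖ - j)
-- vanishes on A × A × A exactly off the diagonal. Each of its monomials has degree at most nd, and at most d in
-- each variable, so one of its x-, y- and z-parts has degree at most nd/3. If m is the number of monomials in n
-- variables with these two bounds, then Σ f(x) g(y) h(z) T(x,y,z) = 0 whenever f, g, h : A → 𝔽ₚ are orthogonal
-- to m functions, and linear algebra turns this into |A| ≤ 2m. Finally m ≤ (pX/Y)ⁿ with X < Y, by Markov's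
-- inequality for an exponential weight on the exponents (Chernoff's bound).
module Submission where

open import Algebra.Bundles using (Semiring)
open import Data.Fin.Base using (Fin; zero; suc)
import Data.Fin.Properties as Fin
open import Data.List.Base as List using (List; []; _∷_; _++_; map; length; filter; downFrom; cartesianProductWith)
open import Data.List.Membership.Propositional using (_∈_; _∉_)
open import Data.List.Membership.Propositional.Properties
  using (∈-++⁺ʳ; ∈-map⁺; ∈-filter⁺; ∈-downFrom⁺; ∈-downFrom⁻; ∈-cartesianProductWith⁺; ∈-cartesianProductWith⁻)
open import Data.List.Properties using (length-map; length-++)
open import Data.List.Relation.Unary.All as All using (All; []; _∷_)
open import Data.List.Relation.Unary.All.Properties using (++⁻ˡ)
open import Data.List.Relation.Unary.Any as Any using (here; there)
open import Data.List.Relation.Unary.Any.Properties using (lookup-index)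
open import Data.Nat.Base as ℕ using (ℕ; zero; suc; NonZero)
import Data.Nat.Divisibility as ℕ
import Data.Nat.Properties as ℕ
import Data.Nat.Tactic.RingSolver as ℕSolver
open import Data.Nat.Primality using (Prime; prime⇒nonZero; euclidsLemma; ¬prime[0]; ¬prime[1])
open import Data.Product using (Σ-syntax; ∃-syntax; _×_; _,_; proj₁; proj₂)
open import Data.Sum.Base as Sum using (_⊎_; inj₁; inj₂; [_,_]′)
open import Data.Vec.Base as Vec using (Vec; []; _∷_; lookup)
import Data.Vec.Functional as Vector
open import Data.Vec.Relation.Unary.All as VecAll using ([]; _∷_)
open import Function.Base using (_∘_; const)
open import Level using (0ℓ)
open import Relation.Binary.PropositionalEquality
  using (_≡_; _≢_; refl; sym; trans; cong; cong₂; subst; subst₂; module ≡-Reasoning)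
open import Relation.Nullary using (¬_; yes; no; contradiction; ¬?; _×-dec_)
open import Relation.Nullary.Decidable using (decidable-stable)
open import Relation.Unary using (Pred; Decidable)

-- Arithmetic modulo `p` takes place in ℤ, with divisibility by `p` as equality, so no field 𝔽ₚ is
-- constructed; elimination multiplies by pivots where it would otherwise divide. The saving comes
-- from a mismatch of means: an exponent uniform on 0, ..., d has mean d/2, while total degree nd/3
-- allows only mean d/3, so a weight that decreases slightly in the exponent favours the vectors to
-- be counted. If the weights of the exponents 0 and d are in the ratio y³, the mean weight is at
-- most the mean of these two end values, and comparison with the weight at d/3 leaves a factor (y³
-- + 1)/(2y²) per coordinate. This is `X`/`Y`, and it is below 1 exactly when 1 < y < (1 + √5)/2.
-- The weights are powers of the cubes s³ and q³ because the weight at d/3 involves cube roots.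

private variable
  A B : Set

-- Words over a finite alphabet, and sums over them

words : ∀ n → List A → List (Vec A n)
words zero    xs = [] ∷ []
words (suc n) xs = cartesianProductWith _∷_ xs (words n xs)

∈-words⁺ : ∀ {n} {xs : List A} {w : Vec A n} → VecAll.All (_∈ xs) w → w ∈ words n xs
∈-words⁺ []       = here refl
∈-words⁺ (p ∷ ps) = ∈-cartesianProductWith⁺ _∷_ p (∈-words⁺ ps)

∈-words⁻ : ∀ n {xs : List A} {w : Vec A n} → w ∈ words n xs → VecAll.All (_∈ xs) w
∈-words⁻ zero    {w = []} _ = []
∈-words⁻ (suc n) {xs} w∈ with ∈-cartesianProductWith⁻ _∷_ xs (words n xs) w∈
... | _ , _ , a∈ , v∈ , refl = a∈ ∷ ∈-words⁻ n v∈

module WordSums (R : Semiring 0ℓ 0ℓ) where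
  open Semiring R hiding (zero) renaming (Carrier to C; _+_ to _⊕_; _*_ to _⊗_; refl to ≈-refl; sym to ≈-sym; trans to ≈-trans)
  open import Relation.Binary.Reasoning.Setoid setoid

  Σᴸ : List A → (A → C) → C
  Σᴸ []       f = 0#
  Σᴸ (x ∷ xs) f = f x ⊕ Σᴸ xs f

  ∏ : ∀ {n} → (Fin n → C) → C
  ∏ = Vector.foldr _⊗_ 1#

  Σᴸ-++ : ∀ (xs ys : List A) f → Σᴸ (xs ++ ys) f ≈ Σᴸ xs f ⊕ Σᴸ ys f
  Σᴸ-++ []       ys f = ≈-sym (+-identityˡ _)
  Σᴸ-++ (x ∷ xs) ys f = ≈-trans (+-congˡ (Σᴸ-++ xs ys f)) (≈-sym (+-assoc _ _ _))

  Σᴸ-map : ∀ (g : B → A) ys f → Σᴸ (map g ys) f ≈ Σᴸ ys (f ∘ g)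
  Σᴸ-map g []       f = ≈-refl
  Σᴸ-map g (y ∷ ys) f = +-congˡ (Σᴸ-map g ys f)

  *-distribˡ-Σᴸ : ∀ c (xs : List A) f → c ⊗ Σᴸ xs f ≈ Σᴸ xs (λ x → c ⊗ f x)
  *-distribˡ-Σᴸ c []       f = zeroʳ c
  *-distribˡ-Σᴸ c (x ∷ xs) f = ≈-trans (distribˡ c _ _) (+-congˡ (*-distribˡ-Σᴸ c xs f))

  -- Multiplying out a product of n sums gives one summand for each word of choices. Over ℕ this
  -- factors the total weight of all exponent vectors; over ℤ it expands the polynomial T into
  -- terms.
  Σᴸ-words : ∀ {n} (xs : List A) (f : Fin n → A → C) →
             Σᴸ (words n xs) (λ w → ∏ (λ k → f k (lookup w k))) ≈ ∏ (λ k → Σᴸ xs (f k))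
  Σᴸ-words {n = zero}  xs f = +-identityʳ 1#
  Σᴸ-words {n = suc n} xs f = begin
    Σᴸ (words (suc n) xs) _                    ≈⟨ go xs ⟩
    Σᴸ xs (f zero) ⊗ Σᴸ (words n xs) rest      ≈⟨ *-congˡ (Σᴸ-words xs (f ∘ suc)) ⟩
    Σᴸ xs (f zero) ⊗ ∏ (λ k → Σᴸ xs (f (suc k))) ∎
    where
    rest : Vec _ n → C
    rest w = ∏ (λ k → f (suc k) (lookup w k))
    go : ∀ ys → Σᴸ (cartesianProductWith _∷_ ys (words n xs)) (λ w → ∏ (λ k → f k (lookup w k)))
                ≈ Σᴸ ys (f zero) ⊗ Σᴸ (words n xs) rest
    go []       = ≈-sym (zeroˡ _)
    go (y ∷ ys) = begin
      Σᴸ (map (y ∷_) (words n xs) ++ cartesianProductWith _∷_ ys (words n xs)) _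
        ≈⟨ Σᴸ-++ (map (y ∷_) (words n xs)) _ _ ⟩
      Σᴸ (map (y ∷_) (words n xs)) _ ⊕ Σᴸ (cartesianProductWith _∷_ ys (words n xs)) _
        ≈⟨ +-cong (Σᴸ-map (y ∷_) (words n xs) _) (go ys) ⟩
      Σᴸ (words n xs) (λ w → f zero y ⊗ rest w) ⊕ Σᴸ ys (f zero) ⊗ Σᴸ (words n xs) rest
        ≈⟨ +-congʳ (*-distribˡ-Σᴸ (f zero y) (words n xs) rest) ⟨
      f zero y ⊗ Σᴸ (words n xs) rest ⊕ Σᴸ ys (f zero) ⊗ Σᴸ (words n xs) rest
        ≈⟨ distribʳ _ _ _ ⟨
      (f zero y ⊕ Σᴸ ys (f zero)) ⊗ Σᴸ (words n xs) rest ∎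

-- Counting the exponent vectors of low degree

module Counting where
  open import Data.Nat.Base
  open import Data.Nat.Properties
  open import Data.Nat.Tactic.RingSolver using (solve-∀)
  open WordSums +-*-semiring

  exponents : ∀ D n → List (Vec ℕ n)
  exponents D n = words n (downFrom (suc D))

  lowExponents : ∀ D n → List (Vec ℕ n)
  lowExponents D n = filter (λ α → 3 * Vec.sum α ≤? n * D) (exponents D n)

  ^-distribʳ-* : ∀ o m n → (m * n) ^ o ≡ m ^ o * n ^ o
  ^-distribʳ-* zero    m n = refl
  ^-distribʳ-* (suc o) m n = trans (cong (m * n *_) (^-distribʳ-* o m n)) (lem m n (m ^ o) (n ^ o))
    where
    lem : ∀ x y z w → x * y * (z * w) ≡ x * z * (y * w)
    lem = solve-∀

  ∏-const : ∀ n c → ∏ {n} (const c) ≡ c ^ n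
  ∏-const zero    c = refl
  ∏-const (suc n) c = cong (c *_) (∏-const n c)

  -- Markov's inequality: an element that passes the filter contributes at least `c` to the sum, any
  -- other at least 0.
  length-filter*≤Σᴸ : ∀ {P : Pred A 0ℓ} (P? : Decidable P) (xs : List A) f c →
                      (∀ {x} → x ∈ xs → P x → c ≤ f x) → length (filter P? xs) * c ≤ Σᴸ xs f
  length-filter*≤Σᴸ P? []       f c c≤f = z≤n
  length-filter*≤Σᴸ P? (x ∷ xs) f c c≤f with P? x
  ... | yes Px = +-mono-≤ (c≤f (here refl) Px) (length-filter*≤Σᴸ P? xs f c (c≤f ∘ there))
  ... | no  _  = m≤n⇒m≤o+n (f x) (length-filter*≤Σᴸ P? xs f c (c≤f ∘ there))

  -- The exponential weight (r/t)^a, multiplied by t^D to stay in ℕ.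
  weight : ℕ → ℕ → ℕ → ℕ → ℕ
  weight t r D a = t ^ (D ∸ a) * r ^ a

  geometric : ℕ → ℕ → ℕ → ℕ
  geometric t r D = Σᴸ (downFrom (suc D)) (weight t r D)

  Σᴸ-cong : ∀ (xs : List A) {f g} → (∀ {x} → x ∈ xs → f x ≡ g x) → Σᴸ xs f ≡ Σᴸ xs g
  Σᴸ-cong []       eq = refl
  Σᴸ-cong (x ∷ xs) eq = cong₂ _+_ (eq (here refl)) (Σᴸ-cong xs (eq ∘ there))

  module _ (t r : ℕ) where
    open ≡-Reasoning

    geometric-sucˡ : ∀ D → geometric t r (suc D) ≡ r ^ suc D + t * geometric t r D
    geometric-sucˡ D = cong₂ _+_
      (trans (cong (λ z → t ^ z * r ^ suc D) (n∸n≡0 D)) (*-identityˡ (r ^ suc D)))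
      (begin
        Σᴸ (downFrom (suc D)) (weight t r (suc D))         ≡⟨ Σᴸ-cong (downFrom (suc D)) step ⟩
        Σᴸ (downFrom (suc D)) (λ a → t * weight t r D a)   ≡⟨ *-distribˡ-Σᴸ t (downFrom (suc D)) (weight t r D) ⟨
        t * geometric t r D                                ∎)
      where
      step : ∀ {a} → a ∈ downFrom (suc D) → weight t r (suc D) a ≡ t * weight t r D a
      step {a} a∈ = begin
        t ^ (suc D ∸ a) * r ^ a     ≡⟨ cong (λ z → t ^ z * r ^ a) (+-∸-assoc 1 (≤-pred (∈-downFrom⁻ a∈))) ⟩
        t * t ^ (D ∸ a) * r ^ a     ≡⟨ *-assoc t _ _ ⟩
        t * (t ^ (D ∸ a) * r ^ a)   ∎

    -- Splits off the exponent 0 instead of the top one. `downFrom` exposes only the top exponent,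
    -- hence the induction through `geometric-sucˡ`.
    geometric-sucʳ : ∀ D → geometric t r (suc D) ≡ r * geometric t r D + t ^ suc D
    geometric-sucʳ zero    = lem t r
      where
      lem : ∀ t r → 1 * (r * 1) + (t * 1 * 1 + 0) ≡ r * (1 * 1 + 0) + t * 1
      lem = solve-∀
    geometric-sucʳ (suc D) = begin
      geometric t r (suc (suc D))                         ≡⟨ geometric-sucˡ (suc D) ⟩
      r * r ^ suc D + t * geometric t r (suc D)           ≡⟨ cong (λ z → r * r ^ suc D + t * z) (geometric-sucʳ D) ⟩
      r * r ^ suc D + t * (r * geometric t r D + t ^ suc D) ≡⟨ lem t r (r ^ suc D) (geometric t r D) (t ^ suc D) ⟩
      r * (r ^ suc D + t * geometric t r D) + t * t ^ suc D ≡⟨ cong (λ z → r * z + t * t ^ suc D) (geometric-sucˡ D) ⟨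
      r * geometric t r (suc D) + t ^ suc (suc D)         ∎
      where
      lem : ∀ t r b g a → r * b + t * (r * g + a) ≡ r * (b + t * g) + t * a
      lem = solve-∀

  -- The right side exceeds the left by (t - r)(a - b).
  chebyshev-sum₂ : ∀ {r t b a} → r ≤ t → b ≤ a → (t + r) * (a + b) ≤ 2 * (t * a + r * b)
  chebyshev-sum₂ {r} {t} {b} {a} r≤t b≤a with m≤n⇒∃[o]m+o≡n r≤t | m≤n⇒∃[o]m+o≡n b≤a
  ... | e , refl | f , refl = subst ((r + e + r) * (b + f + b) ≤_) (lem r e b f) (m≤m+n _ (e * f))
    where
    lem : ∀ r e b f → (r + e + r) * (b + f + b) + e * f ≡ 2 * ((r + e) * (b + f) + r * b)
    lem = solve-∀

  -- Adding the two recurrences for the geometric sum makes the step an instance of Chebyshev's sum inequality.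
  2*geometric≤ : ∀ {t r} D → r ≤ t → 2 * geometric t r D ≤ suc D * (t ^ D + r ^ D)
  2*geometric≤         zero    r≤t = ≤-refl
  2*geometric≤ {t} {r} (suc D) r≤t = *-cancelˡ-≤ 2 (begin
    2 * (2 * G)                                         ≡⟨ lem₁ G ⟩
    2 * (G + G)                                         ≡⟨ cong₂ (λ y z → 2 * (y + z)) (geometric-sucˡ t r D) (geometric-sucʳ t r D) ⟩
    2 * (r * b + t * g + (r * g + t * a))               ≡⟨ lem₂ t r a b g ⟩
    2 * (t * a + r * b) + (t + r) * (2 * g)             ≤⟨ +-monoʳ-≤ (2 * (t * a + r * b)) (*-monoʳ-≤ (t + r) (2*geometric≤ D r≤t)) ⟩
    2 * (t * a + r * b) + (t + r) * (suc D * (a + b))   ≡⟨ cong (2 * (t * a + r * b) +_) (lem₃ (t + r) (suc D) (a + b)) ⟩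
    2 * (t * a + r * b) + suc D * ((t + r) * (a + b))   ≤⟨ +-monoʳ-≤ (2 * (t * a + r * b)) (*-monoʳ-≤ (suc D) (chebyshev-sum₂ r≤t (^-monoˡ-≤ D r≤t))) ⟩
    2 * (t * a + r * b) + suc D * (2 * (t * a + r * b)) ≡⟨ lem₄ (suc D) (t * a + r * b) ⟩
    2 * (suc (suc D) * (t * a + r * b))                 ∎)
    where
    open ≤-Reasoning
    a = t ^ D
    b = r ^ D
    g = geometric t r D
    G = geometric t r (suc D)
    lem₁ : ∀ G → 2 * (2 * G) ≡ 2 * (G + G)
    lem₁ = solve-∀
    lem₂ : ∀ t r a b g → 2 * (r * b + t * g + (r * g + t * a)) ≡ 2 * (t * a + r * b) + (t + r) * (2 * g)
    lem₂ = solve-∀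
    lem₃ : ∀ x d y → x * (d * y) ≡ d * (x * y)
    lem₃ = solve-∀
    lem₄ : ∀ d z → 2 * z + d * (2 * z) ≡ 2 * ((1 + d) * z)
    lem₄ = solve-∀

  -- The product of the weights depends only on the total degree. The factor `t ^ Vec.sum α` on the
  -- left stands in for a subtraction in the exponent on the right.
  ∏-weight : ∀ t r D {n} {α : Vec ℕ n} → VecAll.All (_∈ downFrom (suc D)) α →
             ∏ (λ k → weight t r D (lookup α k)) * t ^ Vec.sum α ≡ t ^ (n * D) * r ^ Vec.sum α
  ∏-weight t r D                     []       = refl
  ∏-weight t r D {suc n} {a ∷ α} (a∈ ∷ α∈) = begin
    weight t r D a * W * t ^ (a + k)                  ≡⟨ cong (weight t r D a * W *_) (^-distribˡ-+-* t a k) ⟩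
    t ^ (D ∸ a) * r ^ a * W * (t ^ a * t ^ k)         ≡⟨ lem (t ^ (D ∸ a)) (r ^ a) W (t ^ a) (t ^ k) ⟩
    t ^ (D ∸ a) * t ^ a * r ^ a * (W * t ^ k)         ≡⟨ cong₂ (λ y z → y * r ^ a * z) t^D (∏-weight t r D α∈) ⟩
    t ^ D * r ^ a * (t ^ (n * D) * r ^ k)             ≡⟨ lem′ (t ^ D) (r ^ a) (t ^ (n * D)) (r ^ k) ⟩
    t ^ D * t ^ (n * D) * (r ^ a * r ^ k)             ≡⟨ cong₂ _*_ (^-distribˡ-+-* t D (n * D)) (^-distribˡ-+-* r a k) ⟨
    t ^ (D + n * D) * r ^ (a + k)                     ∎
    where
    open ≡-Reasoning
    k = Vec.sum α
    W = ∏ (λ i → weight t r D (lookup α i))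
    t^D : t ^ (D ∸ a) * t ^ a ≡ t ^ D
    t^D = trans (sym (^-distribˡ-+-* t (D ∸ a) a)) (cong (t ^_) (m∸n+n≡m (≤-pred (∈-downFrom⁻ a∈))))
    lem : ∀ x y W z v → x * y * W * (z * v) ≡ x * z * y * (W * v)
    lem = solve-∀
    lem′ : ∀ x y z v → x * y * (z * v) ≡ x * z * (y * v)
    lem′ = solve-∀

  module _ (s q D : ℕ) .{{_ : NonZero s}} (q≤s : q ≤ s) where
    open ≤-Reasoning

    -- For t = s³ and r = q³ this is (t^(2/3) r^(1/3))^D, the weight of the possibly fractional
    -- exponent D/3.
    threshold : ℕ
    threshold = s ^ D * s ^ D * q ^ D

    -- With N = nD, total degree k and 3k + e = N, the product of the weights is s^(2N+e) q^(3k),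
    -- while `threshold ^ n` is s^(2N) q^(3k+e). The only loss is trading q^e for s^e.
    ∏-weight-low : ∀ {n} {α : Vec ℕ n} → α ∈ exponents D n → 3 * Vec.sum α ≤ n * D →
                   threshold ^ n ≤ ∏ (λ k → weight (s ^ 3) (q ^ 3) D (lookup α k))
    ∏-weight-low {n} {α} α∈ low with m≤n⇒∃[o]m+o≡n low
    ... | e , 3k+e≡nD = *-cancelʳ-≤ _ _ ((s ^ 3) ^ k) {{m^n≢0 (s ^ 3) k {{m^n≢0 s 3}}}} (begin
      threshold ^ n * (s ^ 3) ^ k                       ≡⟨ cong (_* (s ^ 3) ^ k) threshold^n ⟩
      s ^ N * s ^ N * q ^ N * (s ^ 3) ^ k               ≡⟨ cong₂ (λ x y → s ^ N * s ^ N * x * y) (trans (cong (q ^_) (sym 3k+e≡nD)) (^-distribˡ-+-* q (3 * k) e)) (^-*-assoc s 3 k) ⟩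
      s ^ N * s ^ N * (q ^ (3 * k) * q ^ e) * s ^ (3 * k) ≤⟨ *-monoˡ-≤ (s ^ (3 * k)) (*-monoʳ-≤ (s ^ N * s ^ N) (*-monoʳ-≤ (q ^ (3 * k)) (^-monoˡ-≤ e q≤s))) ⟩
      s ^ N * s ^ N * (q ^ (3 * k) * s ^ e) * s ^ (3 * k) ≡⟨ lem (s ^ N) (q ^ (3 * k)) (s ^ e) (s ^ (3 * k)) ⟩
      s ^ N * (s ^ N * ((s ^ (3 * k) * s ^ e) * 1)) * q ^ (3 * k)  ≡⟨ cong (λ x → s ^ N * (s ^ N * (x * 1)) * q ^ (3 * k)) (trans (sym (^-distribˡ-+-* s (3 * k) e)) (cong (s ^_) 3k+e≡nD)) ⟩
      (s ^ N) ^ 3 * q ^ (3 * k)                         ≡⟨ cong₂ _*_ (trans (^-*-assoc s N 3) (trans (cong (s ^_) (*-comm N 3)) (sym (^-*-assoc s 3 N)))) (sym (^-*-assoc q 3 k)) ⟩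
      (s ^ 3) ^ N * (q ^ 3) ^ k                         ≡⟨ ∏-weight (s ^ 3) (q ^ 3) D (∈-words⁻ n α∈) ⟨
      ∏ (λ i → weight (s ^ 3) (q ^ 3) D (lookup α i)) * (s ^ 3) ^ k ∎)
      where
      k = Vec.sum α
      N = n * D
      ^D^n : ∀ x → (x ^ D) ^ n ≡ x ^ N
      ^D^n x = trans (^-*-assoc x D n) (cong (x ^_) (*-comm D n))
      threshold^n : threshold ^ n ≡ s ^ N * s ^ N * q ^ N
      threshold^n = trans (^-distribʳ-* n (s ^ D * s ^ D) (q ^ D))
        (cong₂ _*_ (trans (^-distribʳ-* n (s ^ D) (s ^ D)) (cong₂ _*_ (^D^n s) (^D^n s))) (^D^n q))
      lem : ∀ S Q E K → S * S * (Q * E) * K ≡ S * (S * ((K * E) * 1)) * Q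
      lem = solve-∀

    -- Markov's inequality against the total weight, which factors into n copies of `geometric`. The
    -- 2 in each coordinate is the denominator of the mean of the two end weights.
    length-lowExponents : ∀ n → length (lowExponents D n) * (2 * threshold) ^ n
                                ≤ (suc D * ((s ^ 3) ^ D + (q ^ 3) ^ D)) ^ n
    length-lowExponents n = begin
      L * (2 * threshold) ^ n            ≡⟨ cong (L *_) (^-distribʳ-* n 2 threshold) ⟩
      L * (2 ^ n * threshold ^ n)        ≡⟨ lem L (2 ^ n) (threshold ^ n) ⟩
      2 ^ n * (L * threshold ^ n)        ≤⟨ *-monoʳ-≤ (2 ^ n) (length-filter*≤Σᴸ _ (exponents D n) (λ α → ∏ (λ k → weight t r D (lookup α k))) (threshold ^ n) ∏-weight-low) ⟩
      2 ^ n * Σᴸ (exponents D n) (λ α → ∏ (λ k → weight t r D (lookup α k)))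
                                         ≡⟨ cong (2 ^ n *_) (trans (Σᴸ-words {n = n} (downFrom (suc D)) (const (weight t r D))) (∏-const n (geometric t r D))) ⟩
      2 ^ n * geometric t r D ^ n        ≡⟨ ^-distribʳ-* n 2 (geometric t r D) ⟨
      (2 * geometric t r D) ^ n          ≤⟨ ^-monoˡ-≤ n (2*geometric≤ D (^-monoˡ-≤ 3 q≤s)) ⟩
      (suc D * (t ^ D + r ^ D)) ^ n      ∎
      where
      t = s ^ 3
      r = q ^ 3
      L = length (lowExponents D n)
      lem : ∀ x y z → x * (y * z) ≡ y * (x * z)
      lem = solve-∀

  -- Bernoulli's inequality for (1 - 1/(M+1))ʲ, with denominators cleared.
  bernoulli : ∀ {M} j {k} → j + k ≡ M → suc M ^ j * k ≤ M ^ suc j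
  bernoulli {M} zero        refl   = ≤-reflexive (*-comm 1 M)
  bernoulli {M} (suc j) {k} j+k≡M = begin
    suc M * suc M ^ j * k         ≡⟨ lem (suc M) (suc M ^ j) k ⟩
    suc M ^ j * (k + M * k)       ≤⟨ *-monoʳ-≤ (suc M ^ j) (+-monoˡ-≤ (M * k) k≤M) ⟩
    suc M ^ j * (M + M * k)       ≡⟨ lem′ M (suc M ^ j) k ⟩
    M * (suc M ^ j * suc k)       ≤⟨ *-monoʳ-≤ M (bernoulli j (trans (+-suc j k) j+k≡M)) ⟩
    M * M ^ suc j                 ∎
    where
    open ≤-Reasoning
    k≤M : k ≤ M
    k≤M = subst (k ≤_) j+k≡M (m≤n+m k (suc j))
    lem : ∀ m x k → m * x * k ≡ x * (m * k)
    lem = solve-∀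
    lem′ : ∀ m x k → x * (m + m * k) ≡ m * (x * (1 + k))
    lem′ = solve-∀

  -- For y = u/v this says y³ - 2y² + 1 = (y - 1)(y² - y - 1) < 0, where y ≤ 3/2 stays below the
  -- positive root of the second factor.
  u³+v³<2u²v : ∀ {u v} → v < u → 2 * u ≤ 3 * v → u ^ 3 + v ^ 3 < 2 * (u * u * v)
  u³+v³<2u²v {u} {v} v<u 2u≤3v with m≤n⇒∃[o]m+o≡n v<u
  ... | e , refl with m≤n⇒∃[o]m+o≡n 2e≤v
    where
    2e≤v : 2 * suc e ≤ v
    2e≤v = +-cancelˡ-≤ (2 * v) _ _ (subst₂ _≤_ (lem v e) (lem′ v) 2u≤3v)
      where
      lem : ∀ v e → 2 * (1 + v + e) ≡ 2 * v + 2 * (1 + e)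
      lem = solve-∀
      lem′ : ∀ v → 3 * v ≡ 2 * v + v
      lem′ = solve-∀
  -- With u = v + (1 + e) and v = 2(1 + e) + f, the gap between the two sides is a polynomial in 1 +
  -- e and f with positive coefficients, and it contains (1 + e)³.
  ... | f , refl = <-≤-trans (m<m+n _ z<s) (≤-reflexive (lem e f))
    where
    lem : ∀ e f → let v = 2 * (1 + e) + f; u = 1 + v + e in
          u * (u * (u * 1)) + v * (v * (v * 1)) + (1 + e) * ((1 + e) * (1 + e) + 3 * ((1 + e) * f) + f * f) ≡ 2 * (u * u * v)
    lem = solve-∀

  -- Bernoulli's inequality 1 + n/m ≤ (1 + 1/m)^n, with denominators cleared.
  m^n*[m+n]≤m*[1+m]^n : ∀ m n → m ^ n * (m + n) ≤ m * suc m ^ n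
  m^n*[m+n]≤m*[1+m]^n m zero    = ≤-reflexive (lem m)
    where
    lem : ∀ m → 1 * (m + 0) ≡ m * 1
    lem = solve-∀
  m^n*[m+n]≤m*[1+m]^n m (suc n) = begin
    m * m ^ n * (m + suc n)          ≤⟨ m≤m+n _ (m ^ n * n) ⟩
    m * m ^ n * (m + suc n) + m ^ n * n ≡⟨ lem m n (m ^ n) ⟩
    suc m * (m ^ n * (m + n))        ≤⟨ *-monoʳ-≤ (suc m) (m^n*[m+n]≤m*[1+m]^n m n) ⟩
    suc m * (m * suc m ^ n)          ≡⟨ lem′ (suc m) m (suc m ^ n) ⟩
    m * (suc m * suc m ^ n)          ∎
    where
    open ≤-Reasoning
    lem : ∀ m n x → m * x * (m + (1 + n)) + x * n ≡ (1 + m) * (x * (m + n))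
    lem = solve-∀
    lem′ : ∀ x y z → x * (y * z) ≡ y * (x * z)
    lem′ = solve-∀

  -- Since o/m ≥ 1 + 1/m, Bernoulli gives (o/m)^n ≥ 1 + n/m, which is at least 2 once n ≥ m.
  2*^≤^ : ∀ {m o} n .{{_ : NonZero m}} → m < o → m ≤ n → 2 * m ^ n ≤ o ^ n
  2*^≤^ {m} {o} n m<o m≤n = *-cancelˡ-≤ m (begin
    m * (2 * m ^ n)      ≡⟨ lem m (m ^ n) ⟩
    m ^ n * (m + m)      ≤⟨ *-monoʳ-≤ (m ^ n) (+-monoʳ-≤ m m≤n) ⟩
    m ^ n * (m + n)      ≤⟨ m^n*[m+n]≤m*[1+m]^n m n ⟩
    m * suc m ^ n        ≤⟨ *-monoʳ-≤ m (^-monoˡ-≤ n m<o) ⟩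
    m * o ^ n            ∎)
    where
    open ≤-Reasoning
    lem : ∀ m x → m * (2 * x) ≡ x * (m + m)
    lem = solve-∀

  -- The ratio s/q = 1 + 1/(3d) satisfies 1 < (s/q)ᵈ ≤ 3/2, and y³ + 1 < 2y² for 1 < y ≤ 3/2.
  -- By length-lowExponents, this saves a factor X/Y < 1 in every coordinate.
  module _ (d : ℕ) .{{_ : NonZero d}} where
    private
      q s K : ℕ
      q = 3 * d
      s = suc q
      K = threshold s q d (n≤1+n q)

    -- With u = s^d and v = q^d these are u³ + v³ and 2u²v.
    X Y : ℕ
    X = (s ^ 3) ^ d + (q ^ 3) ^ d
    Y = 2 * K

    X≢0 : NonZero X
    X≢0 = >-nonZero (<-≤-trans (m^n>0 (s ^ 3) {{m^n≢0 s 3}} d) (m≤m+n _ _))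

    X<Y : X < Y
    X<Y = subst (_< Y) (cong₂ _+_ (^-swap s) (^-swap q))
      -- Bernoulli with M = 3d and j = d leaves k = 2d: s^d · 2d ≤ 3d · q^d, and cancelling d gives
      -- the bound 3/2 on the ratio.
      (u³+v³<2u²v (^-monoˡ-< d (n<1+n q)) (*-cancelˡ-≤ d (subst₂ _≤_ (lem d (s ^ d)) (lem′ d (q ^ d)) (bernoulli d (lem″ d)))))
      where
      ^-swap : ∀ x → (x ^ d) ^ 3 ≡ (x ^ 3) ^ d
      ^-swap x = trans (^-*-assoc x d 3) (trans (cong (x ^_) (*-comm d 3)) (sym (^-*-assoc x 3 d)))
      lem : ∀ d u → u * (2 * d) ≡ d * (2 * u)
      lem = solve-∀
      lem′ : ∀ d v → 3 * d * v ≡ d * (3 * v)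
      lem′ = solve-∀
      lem″ : ∀ d → d + 2 * d ≡ 3 * d
      lem″ = solve-∀

    2Y≢0 : NonZero (2 * Y)
    2Y≢0 = >-nonZero (<-≤-trans (≤-<-trans z≤n X<Y) (m≤m+n Y (Y + 0)))

    X+Y<2Y : X + Y < 2 * Y
    X+Y<2Y = <-≤-trans (+-monoˡ-< Y X<Y) (≤-reflexive (cong (Y +_) (sym (+-identityʳ Y))))

    -- (X + Y)/(2Y) is the midpoint of X/Y and 1. Moving from X/Y up to it absorbs the factor 2 in
    -- front of the number of monomials as soon as n ≥ 2X.
    lowExponents-bound : ∀ n a → 2 * X ≤ n → a ≤ 2 * length (lowExponents d n) →
                         a * (2 * Y) ^ n ≤ (suc d * (X + Y)) ^ n
    lowExponents-bound n a 2X≤n a≤2L = begin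
      a * (2 * Y) ^ n                   ≤⟨ *-monoˡ-≤ ((2 * Y) ^ n) a≤2L ⟩
      2 * L * (2 * Y) ^ n               ≡⟨ cong (2 * L *_) (^-distribʳ-* n 2 Y) ⟩
      2 * L * (2 ^ n * Y ^ n)           ≡⟨ lem L (2 ^ n) (Y ^ n) ⟩
      2 * 2 ^ n * (L * Y ^ n)           ≤⟨ *-monoʳ-≤ (2 * 2 ^ n) (length-lowExponents s q d (n≤1+n q) n) ⟩
      2 * 2 ^ n * (suc d * X) ^ n       ≡⟨ cong (2 * 2 ^ n *_) (^-distribʳ-* n (suc d) X) ⟩
      2 * 2 ^ n * (suc d ^ n * X ^ n)   ≡⟨ lem′ (2 ^ n) (suc d ^ n) (X ^ n) ⟩
      suc d ^ n * (2 * (2 ^ n * X ^ n)) ≡⟨ cong (λ z → suc d ^ n * (2 * z)) (^-distribʳ-* n 2 X) ⟨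
      suc d ^ n * (2 * (2 * X) ^ n)     ≤⟨ *-monoʳ-≤ (suc d ^ n) (2*^≤^ n {{m*n≢0 2 X {{_}} {{X≢0}}}} 2X<X+Y 2X≤n) ⟩
      suc d ^ n * (X + Y) ^ n           ≡⟨ ^-distribʳ-* n (suc d) (X + Y) ⟨
      (suc d * (X + Y)) ^ n             ∎
      where
      open ≤-Reasoning
      L = length (lowExponents d n)
      2X<X+Y : 2 * X < X + Y
      2X<X+Y = subst (_< X + Y) (cong (X +_) (sym (+-identityʳ X))) (+-monoʳ-< X X<Y)
      lem : ∀ l x y → 2 * l * (x * y) ≡ 2 * x * (l * y)
      lem = solve-∀
      lem′ : ∀ x y z → 2 * x * (y * z) ≡ y * (2 * (x * z))
      lem′ = solve-∀

-- Sums and pairings of integer vectors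

module SliceRank where
  open import Data.Integer.Base hiding (suc; NonZero)
  open import Data.Integer.Properties
  open import Data.Integer.Divisibility.Signed
  open import Data.Integer.Tactic.RingSolver using (solve-∀)
  open import Algebra.Properties.Semiring.Sum +-*-semiring using (sum; sum-cong-≗; ∑-distrib-+; *-distribˡ-sum)
  open Counting using (exponents; lowExponents)
  open WordSums +-*-semiring using (Σᴸ; ∏; Σᴸ-words)

  ∣-sum : ∀ {m n} {t : Fin n → ℤ} → (∀ i → m ∣ t i) → m ∣ sum t
  ∣-sum {n = ℕ.zero}  _   = divides 0ℤ refl
  ∣-sum {n = ℕ.suc n} m∣t = ∣m∣n⇒∣m+n (m∣t zero) (∣-sum (m∣t ∘ suc))

  ∣-sum⇒∣ : ∀ {m n} {t : Fin n → ℤ} i → (∀ j → j ≢ i → m ∣ t j) → m ∣ sum t → m ∣ t i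
  ∣-sum⇒∣ {t = t} zero    m∣t m∣∑ = ∣m+n∣n⇒∣m {m = t zero} m∣∑ (∣-sum (λ j → m∣t (suc j) λ ()))
  ∣-sum⇒∣ {t = t} (suc i) m∣t m∣∑ = ∣-sum⇒∣ i (λ j j≢i → m∣t (suc j) (j≢i ∘ Fin.suc-injective))
    (∣m+n∣m⇒∣n {m = t zero} m∣∑ (m∣t zero λ ()))

  infix 8 ⟨_,_⟩
  ⟨_,_⟩ : ∀ {n} → (Fin n → ℤ) → (Fin n → ℤ) → ℤ
  ⟨ φ , u ⟩ = sum (λ i → φ i * u i)

  δ : ∀ {n} → Fin n → Fin n → ℤ
  δ zero    zero    = 1ℤ
  δ zero    (suc j) = 0ℤ
  δ (suc i) zero    = 0ℤ
  δ (suc i) (suc j) = δ i j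

  δ-diag : ∀ {n} (i : Fin n) → δ i i ≡ 1ℤ
  δ-diag zero    = refl
  δ-diag (suc i) = δ-diag i

  δ-off : ∀ {n} {i j : Fin n} → j ≢ i → δ i j ≡ 0ℤ
  δ-off {i = zero}  {zero}  j≢i = contradiction refl j≢i
  δ-off {i = zero}  {suc j} j≢i = refl
  δ-off {i = suc i} {zero}  j≢i = refl
  δ-off {i = suc i} {suc j} j≢i = δ-off (j≢i ∘ cong suc)

  module _ {n : ℕ} where
    open ≡-Reasoning

    ⟨,⟩-combineʳ : ∀ (φ u w : Fin n → ℤ) a b → ⟨ φ , (λ i → a * u i - b * w i) ⟩ ≡ a * ⟨ φ , u ⟩ - b * ⟨ φ , w ⟩
    ⟨,⟩-combineʳ φ u w a b = begin
      sum (λ i → φ i * (a * u i - b * w i))                          ≡⟨ sum-cong-≗ (λ i → lem (φ i) a (u i) b (w i)) ⟩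
      sum (λ i → a * (φ i * u i) + (- b) * (φ i * w i))              ≡⟨ ∑-distrib-+ (λ i → a * (φ i * u i)) (λ i → (- b) * (φ i * w i)) ⟩
      sum (λ i → a * (φ i * u i)) + sum (λ i → (- b) * (φ i * w i))  ≡⟨ cong₂ _+_ (*-distribˡ-sum a (λ i → φ i * u i)) (*-distribˡ-sum (- b) (λ i → φ i * w i)) ⟨
      a * ⟨ φ , u ⟩ + (- b) * ⟨ φ , w ⟩                              ≡⟨ cong (λ z → a * ⟨ φ , u ⟩ + z) (neg-distribˡ-* b ⟨ φ , w ⟩) ⟨
      a * ⟨ φ , u ⟩ - b * ⟨ φ , w ⟩                                  ∎
      where
      lem : ∀ f a u b w → f * (a * u - b * w) ≡ a * (f * u) + (- b) * (f * w)
      lem = solve-∀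

    ⟨,⟩-comm : ∀ (φ u : Fin n → ℤ) → ⟨ φ , u ⟩ ≡ ⟨ u , φ ⟩
    ⟨,⟩-comm φ u = sum-cong-≗ (λ i → *-comm (φ i) (u i))

    ⟨,⟩-combineˡ : ∀ (φ ψ u : Fin n → ℤ) a b → ⟨ (λ i → a * φ i - b * ψ i) , u ⟩ ≡ a * ⟨ φ , u ⟩ - b * ⟨ ψ , u ⟩
    ⟨,⟩-combineˡ φ ψ u a b = begin
      ⟨ (λ i → a * φ i - b * ψ i) , u ⟩   ≡⟨ ⟨,⟩-comm (λ i → a * φ i - b * ψ i) u ⟩
      ⟨ u , (λ i → a * φ i - b * ψ i) ⟩   ≡⟨ ⟨,⟩-combineʳ u φ ψ a b ⟩
      a * ⟨ u , φ ⟩ - b * ⟨ u , ψ ⟩       ≡⟨ cong₂ (λ x y → a * x - b * y) (⟨,⟩-comm u φ) (⟨,⟩-comm u ψ) ⟩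
      a * ⟨ φ , u ⟩ - b * ⟨ ψ , u ⟩       ∎

  sum-zero : ∀ {n} {t : Fin n → ℤ} → (∀ i → t i ≡ 0ℤ) → sum t ≡ 0ℤ
  sum-zero {ℕ.zero}  eq = refl
  sum-zero {ℕ.suc n} eq = cong₂ _+_ (eq zero) (sum-zero (eq ∘ suc))

  ⟨,δ⟩ : ∀ {n} (φ : Fin n → ℤ) i → ⟨ φ , δ i ⟩ ≡ φ i
  ⟨,δ⟩ φ zero    = trans (cong₂ _+_ (*-identityʳ (φ zero)) (sum-zero (λ j → *-zeroʳ (φ (suc j))))) (+-identityʳ (φ zero))
  ⟨,δ⟩ φ (suc i) = trans (cong₂ _+_ (*-zeroʳ (φ zero)) (⟨,δ⟩ (φ ∘ suc) i)) (+-identityˡ (φ (suc i)))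

  -- Gaussian elimination modulo a prime, without inverses

  module ModPrime {p : ℕ} (prime : Prime p) where

    infix 4 p∣_
    p∣_ : ℤ → Set
    p∣ a = + p ∣ a

    euclid : ∀ a b → p∣ a * b → p∣ a ⊎ p∣ b
    euclid a b p∣ab = Sum.map ∣ᵤ⇒∣ ∣ᵤ⇒∣
      (euclidsLemma ∣ a ∣ ∣ b ∣ prime (subst (p ℕ.∣_) (abs-* a b) (∣⇒∣ᵤ p∣ab)))

    ∤-* : ∀ {a b} → ¬ p∣ a → ¬ p∣ b → ¬ p∣ a * b
    ∤-* {a} {b} p∤a p∤b p∣ab = [ p∤a , p∤b ]′ (euclid a b p∣ab)

    cancel : ∀ {a b} → ¬ p∣ a → p∣ a * b → p∣ b
    cancel {a} {b} p∤a p∣ab = [ (λ p∣a → contradiction p∣a p∤a) , (λ p∣b → p∣b) ]′ (euclid a b p∣ab)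

    p∤1 : ¬ p∣ 1ℤ
    p∤1 p∣1 = contradiction (ℕ.∣1⇒≡1 (∣⇒∣ᵤ p∣1)) (λ where refl → ¬prime[1] prime)

    module _ {N : ℕ} where

      Annihilates : (Fin N → ℤ) → List (Fin N → ℤ) → Set
      Annihilates u = All (λ φ → p∣ ⟨ φ , u ⟩)

      -- The pivots are the bound variables of the system, and all the other coordinates of a
      -- solution can be prescribed, up to the common factor scale, which saves inverting modulo p.
      record Elimination (φs : List (Fin N → ℤ)) : Set where
        field
          pivots       : List (Fin N)
          pivots-bound : length pivots ℕ.≤ length φs
          scale        : ℤ
          scale≢0      : ¬ p∣ scale
          solution     : (Fin N → ℤ) → Fin N → ℤ
          annihilates  : ∀ v → Annihilates (solution v) φs
          free         : ∀ v {i} → i ∉ pivots → solution v i ≡ scale * v i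

      -- The recursion is on the length `m`, because the recursive call is on `map reduce φs`, which
      -- is not a part of the given list.
      eliminate : ∀ m φs → length φs ≡ m → Elimination φs
      eliminate ℕ.zero [] _ = record
        { pivots       = []
        ; pivots-bound = ℕ.z≤n
        ; scale        = 1ℤ
        ; scale≢0      = p∤1
        ; solution     = λ v → v
        ; annihilates  = λ v → []
        ; free         = λ v {i} _ → sym (*-identityˡ (v i))
        }
      eliminate (ℕ.suc m) (φ ∷ φs) eq with Fin.any? (λ i → ¬? (+ p ∣? φ i))
      -- A form that is zero modulo `p` imposes no condition and uses up no pivot.
      ... | no  φ≡0 = record
        { pivots       = pivots
        ; pivots-bound = ℕ.m≤n⇒m≤1+n pivots-bound
        ; scale        = scale
        ; scale≢0      = scale≢0
        ; solution     = solution
        ; annihilates  = λ v → ∣-sum (λ i → ∣m⇒∣m*n (solution v i) (decidable-stable (+ p ∣? φ i) (λ p∤ → φ≡0 (i , p∤)))) ∷ annihilates v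
        ; free         = free
        }
        where open Elimination (eliminate m φs (ℕ.suc-injective eq))
      ... | yes (i , φᵢ≢0) = record
        { pivots       = i ∷ E.pivots
        ; pivots-bound = ℕ.s≤s (subst (length E.pivots ℕ.≤_) (length-map reduce φs) E.pivots-bound)
        ; scale        = φ i * E.scale
        ; scale≢0      = ∤-* φᵢ≢0 E.scale≢0
        ; solution     = solution
        ; annihilates  = λ v → φ-zero v ∷ All.tabulate (λ {ψ} ψ∈ → ψ-zero v ψ (All.lookup (E.annihilates v) (∈-map⁺ reduce ψ∈)))
        ; free         = λ v {j} j∉ → begin
            φ i * E.solution v j - ⟨ φ , E.solution v ⟩ * δ i j   ≡⟨ cong₂ (λ x y → φ i * x - ⟨ φ , E.solution v ⟩ * y) (E.free v (j∉ ∘ there)) (δ-off (j∉ ∘ here)) ⟩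
            φ i * (E.scale * v j) - ⟨ φ , E.solution v ⟩ * 0ℤ     ≡⟨ lem (φ i) E.scale (v j) ⟨ φ , E.solution v ⟩ ⟩
            φ i * E.scale * v j                                   ∎
        }
        where
        open ≡-Reasoning
        -- Cross-multiplication makes the coefficient at the pivot i equal to φᵢψᵢ - ψᵢφᵢ = 0; it
        -- also sends φ itself to 0.
        reduce : (Fin N → ℤ) → Fin N → ℤ
        reduce ψ j = φ i * ψ j - ψ i * φ j
        module E = Elimination (eliminate m (map reduce φs) (trans (length-map reduce φs) (ℕ.suc-injective eq)))
        -- The solution of the reduced system is scaled by φᵢ and corrected at coordinate i alone.
        -- This map is the transpose of `reduce`, so ψ pairs with the new vector as `reduce ψ` pairs
        -- with the old one.
        solution : (Fin N → ℤ) → Fin N → ℤ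
        solution v j = φ i * E.solution v j - ⟨ φ , E.solution v ⟩ * δ i j
        ⟨,solution⟩ : ∀ ψ v → ⟨ ψ , solution v ⟩ ≡ ⟨ reduce ψ , E.solution v ⟩
        ⟨,solution⟩ ψ v = begin
          ⟨ ψ , solution v ⟩                                                 ≡⟨ ⟨,⟩-combineʳ ψ (E.solution v) (δ i) (φ i) ⟨ φ , E.solution v ⟩ ⟩
          φ i * ⟨ ψ , E.solution v ⟩ - ⟨ φ , E.solution v ⟩ * ⟨ ψ , δ i ⟩    ≡⟨ cong (λ z → φ i * ⟨ ψ , E.solution v ⟩ - z) (trans (cong (⟨ φ , E.solution v ⟩ *_) (⟨,δ⟩ ψ i)) (*-comm ⟨ φ , E.solution v ⟩ (ψ i))) ⟩
          φ i * ⟨ ψ , E.solution v ⟩ - ψ i * ⟨ φ , E.solution v ⟩            ≡⟨ ⟨,⟩-combineˡ ψ φ (E.solution v) (φ i) (ψ i) ⟨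
          ⟨ reduce ψ , E.solution v ⟩                                        ∎
        φ-zero : ∀ v → p∣ ⟨ φ , solution v ⟩
        φ-zero v = subst p∣_ (sym (trans (⟨,solution⟩ φ v) (sum-zero (λ j → lem₀ (φ i) (φ j) (E.solution v j))))) (divides 0ℤ refl)
          where
          lem₀ : ∀ x y z → (x * y - x * y) * z ≡ 0ℤ
          lem₀ = solve-∀
        ψ-zero : ∀ v ψ → p∣ ⟨ reduce ψ , E.solution v ⟩ → p∣ ⟨ ψ , solution v ⟩
        ψ-zero v ψ = subst p∣_ (sym (⟨,solution⟩ ψ v))
        lem : ∀ x s v y → x * (s * v) - y * 0ℤ ≡ x * s * v
        lem = solve-∀

      open import Data.List.Membership.DecPropositional (Fin._≟_ {N}) using (_∈?_)

      ∃∉ : ∀ (xs : List (Fin N)) → length xs ℕ.< N → ∃[ i ] i ∉ xs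
      ∃∉ xs len<N with Fin.any? (λ i → ¬? (i ∈? xs))
      ... | yes i∉ = i∉
      ... | no  ∀∈ = contradiction (trans (lookup-index (∈xs i)) (trans (cong (List.lookup xs) idx≡) (sym (lookup-index (∈xs j))))) (Fin.<⇒≢ i<j)
        where
        ∈xs : ∀ i → i ∈ xs
        ∈xs i = decidable-stable (i ∈? xs) (λ i∉ → ∀∈ (i , i∉))
        ph = Fin.pigeonhole len<N (Any.index ∘ ∈xs)
        i = proj₁ ph
        j = proj₁ (proj₂ ph)
        i<j = proj₁ (proj₂ (proj₂ ph))
        idx≡ = proj₂ (proj₂ (proj₂ ph))

  -- Tensors and their contraction with three vectors

  Tensor : ℕ → Set
  Tensor N = Fin N → Fin N → Fin N → ℤ

  contract : ∀ {N} (f g h : Fin N → ℤ) → Tensor N → ℤ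
  contract f g h T = ⟨ f , (λ i → ⟨ g , (λ j → ⟨ h , T i j ⟩) ⟩) ⟩

  module _ {N : ℕ} where
    open ≡-Reasoning

    ⟨,⟩-congʳ : ∀ (f : Fin N → ℤ) {u w} → (∀ i → u i ≡ w i) → ⟨ f , u ⟩ ≡ ⟨ f , w ⟩
    ⟨,⟩-congʳ f eq = sum-cong-≗ (λ i → cong (f i *_) (eq i))

    ⟨,⟩-+ : ∀ (f u w : Fin N → ℤ) → ⟨ f , (λ i → u i + w i) ⟩ ≡ ⟨ f , u ⟩ + ⟨ f , w ⟩
    ⟨,⟩-+ f u w = trans (sum-cong-≗ (λ i → *-distribˡ-+ (f i) (u i) (w i)))
                        (∑-distrib-+ (λ i → f i * u i) (λ i → f i * w i))

    ⟨,⟩-* : ∀ (f : Fin N → ℤ) a u → ⟨ f , (λ i → a * u i) ⟩ ≡ a * ⟨ f , u ⟩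
    ⟨,⟩-* f a u = trans (sum-cong-≗ (λ i → lem (f i) a (u i))) (sym (*-distribˡ-sum a (λ i → f i * u i)))
      where
      lem : ∀ x y z → x * (y * z) ≡ y * (x * z)
      lem = solve-∀

    module _ (f g h : Fin N → ℤ) where

      contract-cong : ∀ {T U : Tensor N} → (∀ i j k → T i j k ≡ U i j k) → contract f g h T ≡ contract f g h U
      contract-cong eq = ⟨,⟩-congʳ f (λ i → ⟨,⟩-congʳ g (λ j → ⟨,⟩-congʳ h (eq i j)))

      contract-+ : ∀ (T U : Tensor N) → contract f g h (λ i j k → T i j k + U i j k) ≡ contract f g h T + contract f g h U
      contract-+ T U = begin
        contract f g h (λ i j k → T i j k + U i j k)
          ≡⟨ ⟨,⟩-congʳ f (λ i → ⟨,⟩-congʳ g (λ j → ⟨,⟩-+ h (T i j) (U i j))) ⟩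
        ⟨ f , (λ i → ⟨ g , (λ j → ⟨ h , T i j ⟩ + ⟨ h , U i j ⟩) ⟩) ⟩
          ≡⟨ ⟨,⟩-congʳ f (λ i → ⟨,⟩-+ g (λ j → ⟨ h , T i j ⟩) (λ j → ⟨ h , U i j ⟩)) ⟩
        ⟨ f , (λ i → ⟨ g , (λ j → ⟨ h , T i j ⟩) ⟩ + ⟨ g , (λ j → ⟨ h , U i j ⟩) ⟩) ⟩
          ≡⟨ ⟨,⟩-+ f (λ i → ⟨ g , (λ j → ⟨ h , T i j ⟩) ⟩) (λ i → ⟨ g , (λ j → ⟨ h , U i j ⟩) ⟩) ⟩
        contract f g h T + contract f g h U ∎

      contract-zero : contract f g h (λ _ _ _ → 0ℤ) ≡ 0ℤ
      contract-zero = ⟨,0⟩ f (λ i → ⟨,0⟩ g (λ j → ⟨,0⟩ h (λ k → refl)))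
        where
        ⟨,0⟩ : ∀ (f : Fin N → ℤ) {u} → (∀ i → u i ≡ 0ℤ) → ⟨ f , u ⟩ ≡ 0ℤ
        ⟨,0⟩ f eq = sum-zero (λ i → trans (cong (f i *_) (eq i)) (*-zeroʳ (f i)))

      -- A product tensor contracts to a product of pairings, so a single pairing divisible by `p`
      -- disposes of the whole term.
      contract-rankOne : ∀ c (u v w : Fin N → ℤ) →
                         contract f g h (λ i j k → c * (u i * (v j * w k))) ≡ c * (⟨ f , u ⟩ * (⟨ g , v ⟩ * ⟨ h , w ⟩))
      contract-rankOne c u v w = begin
        contract f g h (λ i j k → c * (u i * (v j * w k)))
          ≡⟨ contract-cong (λ i j k → lem c (u i) (v j) (w k)) ⟩
        contract f g h (λ i j k → (c * u i * v j) * w k)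
          ≡⟨ ⟨,⟩-congʳ f (λ i → ⟨,⟩-congʳ g (λ j → trans (⟨,⟩-* h (c * u i * v j) w) (lem′ c (u i) (v j) H))) ⟩
        ⟨ f , (λ i → ⟨ g , (λ j → (c * u i * H) * v j) ⟩) ⟩
          ≡⟨ ⟨,⟩-congʳ f (λ i → trans (⟨,⟩-* g (c * u i * H) v) (lem″ c (u i) H G)) ⟩
        ⟨ f , (λ i → (c * (G * H)) * u i) ⟩
          ≡⟨ ⟨,⟩-* f (c * (G * H)) u ⟩
        c * (G * H) * ⟨ f , u ⟩
          ≡⟨ lem‴ c G H ⟨ f , u ⟩ ⟩
        c * (⟨ f , u ⟩ * (G * H)) ∎
        where
        G = ⟨ g , v ⟩
        H = ⟨ h , w ⟩
        lem : ∀ c u v w → c * (u * (v * w)) ≡ c * u * v * w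
        lem = solve-∀
        lem′ : ∀ c u v w → c * u * v * w ≡ c * u * w * v
        lem′ = solve-∀
        lem″ : ∀ c u w v → c * u * w * v ≡ c * (v * w) * u
        lem″ = solve-∀
        lem‴ : ∀ c v w u → c * (v * w) * u ≡ c * (u * (v * w))
        lem‴ = solve-∀

      ∣-contract-Σᴸ : ∀ {m} (ts : List A) (R : A → Tensor N) → (∀ {t} → t ∈ ts → m ∣ contract f g h (R t)) →
                      m ∣ contract f g h (λ i j k → Σᴸ ts (λ t → R t i j k))
      ∣-contract-Σᴸ []       R m∣R = subst (_ ∣_) (sym contract-zero) (divides 0ℤ refl)
      ∣-contract-Σᴸ (t ∷ ts) R m∣R = subst (_ ∣_) (sym (contract-+ (R t) _))
        (∣m∣n⇒∣m+n (m∣R (here refl)) (∣-contract-Σᴸ ts R (m∣R ∘ there)))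

  module _ {p : ℕ} (prime : Prime p) where
    open ModPrime prime

    -- A tensor which is killed by all triples of vectors annihilated by Φ cannot be diagonal if
    -- N > 2 |Φ|: let f and h be solutions of the same system with f ≡ 1 and h ≡ δᵢ outside its
    -- pivots, and let g be a solution vanishing at the pivots with gᵢ ≢ 0.
    diagonal-bound : ∀ {N} (Φ : List (Fin N → ℤ)) (T : Tensor N) →
      (∀ f g h → Annihilates f Φ → Annihilates g Φ → Annihilates h Φ → p∣ contract f g h T) →
      (∀ i j k → ¬ (j ≡ i × k ≡ i) → p∣ T i j k) →
      (∀ i → ¬ p∣ T i i i) →
      N ℕ.≤ 2 ℕ.* length Φ
    diagonal-bound {N} Φ T killed off diag = ℕ.≮⇒≥ impossible
      where
      open import Data.List.Membership.DecPropositional (Fin._≟_ {N}) using (_∈?_)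
      module E = Elimination (eliminate (length Φ) Φ refl)
      -- Vanishing at the pivot j is the linear equation ⟨ δ j , g ⟩ = 0. There are at most |Φ| of
      -- these, whence the factor 2 in the bound.
      Ψ = Φ ++ map δ E.pivots
      module G = Elimination (eliminate (length Ψ) Ψ refl)

      pivots-bound : length G.pivots ℕ.≤ 2 ℕ.* length Φ
      pivots-bound = begin
        length G.pivots                      ≤⟨ G.pivots-bound ⟩
        length Ψ                             ≡⟨ length-++ Φ ⟩
        length Φ ℕ.+ length (map δ E.pivots) ≡⟨ cong (length Φ ℕ.+_) (length-map δ E.pivots) ⟩
        length Φ ℕ.+ length E.pivots         ≤⟨ ℕ.+-monoʳ-≤ (length Φ) E.pivots-bound ⟩
        length Φ ℕ.+ length Φ                ≡⟨ cong (length Φ ℕ.+_) (ℕ.+-identityʳ (length Φ)) ⟨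
        2 ℕ.* length Φ                       ∎
        where open ℕ.≤-Reasoning

      f = E.solution (const 1ℤ)
      g = G.solution (const 1ℤ)

      g-pivot : ∀ {j} → j ∈ E.pivots → p∣ g j
      g-pivot {j} j∈ = subst p∣_ (trans (⟨,⟩-comm (δ j) g) (⟨,δ⟩ g j))
        (All.lookup (G.annihilates (const 1ℤ)) (∈-++⁺ʳ Φ (∈-map⁺ δ j∈)))

      g-annihilates : Annihilates g Φ
      g-annihilates = ++⁻ˡ Φ (G.annihilates (const 1ℤ))

      impossible : ¬ (2 ℕ.* length Φ ℕ.< N)
      -- From the inside out, the sums over the first, second and third index are reduced to their
      -- terms at i, cancelling fᵢ and then gᵢ on the way. What remains is hᵢ T i i i, a product of
      -- two units modulo `p`.
      impossible 2Φ<N = ∤-* h≢0 (diag i) (∣-sum⇒∣ i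
          (λ k k≢i → cancel g≢0 (small i i k (λ (_ , _ , k≡i) → k≢i k≡i)))
          (cancel g≢0 (∣-sum⇒∣ i
            (λ j j≢i → inner i j (λ k (_ , j≡i , _) → j≢i j≡i))
            (cancel f≢0 (∣-sum⇒∣ i
              (λ k k≢i → ∣n⇒∣m*n (f k) (∣-sum (λ j → inner k j (λ _ (k≡i , _) → k≢i k≡i))))
              (killed f g h (E.annihilates (const 1ℤ)) g-annihilates (E.annihilates (δ i))))))))
        where
        found = ∃∉ G.pivots (ℕ.≤-<-trans pivots-bound 2Φ<N)
        i = proj₁ found
        h = E.solution (δ i)
        g≢0 : ¬ p∣ g i
        g≢0 = subst (λ z → ¬ p∣ z) (sym (trans (G.free (const 1ℤ) (proj₂ found)) (*-identityʳ G.scale))) G.scale≢0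
        i∉ : i ∉ E.pivots
        i∉ = g≢0 ∘ g-pivot
        f≢0 : ¬ p∣ f i
        f≢0 = subst (λ z → ¬ p∣ z) (sym (trans (E.free (const 1ℤ) i∉) (*-identityʳ E.scale))) E.scale≢0
        h≢0 : ¬ p∣ h i
        h≢0 = subst (λ z → ¬ p∣ z)
          (sym (trans (E.free (δ i) i∉) (trans (cong (E.scale *_) (δ-diag i)) (*-identityʳ E.scale)))) E.scale≢0
        -- Every other term dies for one of three reasons: T vanishes off the diagonal, g vanishes
        -- at the pivots of `E`, and h is a multiple of `δ i` away from them. The factor g is kept
        -- because h is not controlled at the pivots.
        small : ∀ a b c → ¬ (a ≡ i × b ≡ i × c ≡ i) → p∣ g b * (h c * T a b c)
        small a b c ≢i with (b Fin.≟ a) ×-dec (c Fin.≟ a)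
        ... | no  ≢a = ∣n⇒∣m*n (g b) (∣n⇒∣m*n (h c) (off a b c ≢a))
        ... | yes (refl , refl) with a ∈? E.pivots
        ...   | yes a∈ = ∣m⇒∣m*n (h a * T a a a) (g-pivot a∈)
        ...   | no  a∉ = ∣n⇒∣m*n (g a) (∣m⇒∣m*n (T a a a) (subst p∣_ (sym ha≡0) (divides 0ℤ refl)))
          where
          ha≡0 : h a ≡ 0ℤ
          ha≡0 = trans (E.free (δ i) a∉) (trans (cong (E.scale *_) (δ-off (λ a≡i → ≢i (a≡i , a≡i , a≡i)))) (*-zeroʳ E.scale))
        inner : ∀ a b → (∀ c → ¬ (a ≡ i × b ≡ i × c ≡ i)) → p∣ g b * ⟨ h , T a b ⟩
        inner a b ≢i = subst p∣_ (sym (*-distribˡ-sum (g b) (λ c → h c * T a b c))) (∣-sum (λ c → small a b c (≢i c)))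

  -- The progression polynomial and its terms

  record Term : Set where
    constructor term
    field
      coeff       : ℤ
      deg₁ deg₂ deg₃ : ℕ

    degree : ℕ
    degree = deg₁ ℕ.+ deg₂ ℕ.+ deg₃

  open Term

  eval : Term → ℤ → ℤ → ℤ → ℤ
  eval (term κ a b c) x y z = κ * (x ^ a * (y ^ b * z ^ c))

  -- Up to a unit, the indicator function of 0 on the residues modulo d + 1.
  τ : ℕ → ℤ → ℤ
  τ ℕ.zero    s = 1ℤ
  τ (ℕ.suc d) s = (s - + ℕ.suc d) * τ d s

  -- Multiplies by x - 2y + z - j, turning each term into four. Like terms are not collected: the
  -- argument uses the degree of each term, never their number.
  times : ℕ → List Term → List Term
  times j []       = []
  times j (term κ a b c ∷ ts) =
    term κ (ℕ.suc a) b c ∷ term (- (+ 2) * κ) a (ℕ.suc b) c ∷ term κ a b (ℕ.suc c) ∷ term (- (+ j) * κ) a b c ∷ times j ts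

  τ-terms : ℕ → List Term
  τ-terms ℕ.zero    = term 1ℤ 0 0 0 ∷ []
  τ-terms (ℕ.suc d) = times (ℕ.suc d) (τ-terms d)

  apForm : ℤ → ℤ → ℤ → ℤ
  apForm x y z = x - + 2 * y + z

  module _ (x y z : ℤ) where

    Σᴸ-times : ∀ j ts → Σᴸ (times j ts) (λ t → eval t x y z) ≡ (apForm x y z - + j) * Σᴸ ts (λ t → eval t x y z)
    Σᴸ-times j []       = sym (*-zeroʳ (apForm x y z - + j))
    Σᴸ-times j (term κ a b c ∷ ts) = trans
      (cong (λ S → eval (term κ (ℕ.suc a) b c) x y z + (eval (term (- (+ 2) * κ) a (ℕ.suc b) c) x y z
        + (eval (term κ a b (ℕ.suc c)) x y z + (eval (term (- (+ j) * κ) a b c) x y z + S)))) (Σᴸ-times j ts))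
      (lem x y z (+ j) κ (x ^ a) (y ^ b) (z ^ c) (Σᴸ ts (λ t → eval t x y z)))
      where
      lem : ∀ x y z j κ a b c S →
        κ * (x * a * (b * c)) + (- (+ 2) * κ * (a * (y * b * c)) + (κ * (a * (b * (z * c))) + (- j * κ * (a * (b * c)) + (x - + 2 * y + z - j) * S)))
        ≡ (x - + 2 * y + z - j) * (κ * (a * (b * c)) + S)
      lem = solve-∀

    Σᴸ-τ-terms : ∀ d → Σᴸ (τ-terms d) (λ t → eval t x y z) ≡ τ d (apForm x y z)
    Σᴸ-τ-terms ℕ.zero    = refl
    Σᴸ-τ-terms (ℕ.suc d) = trans (Σᴸ-times (ℕ.suc d) (τ-terms d))
      (cong ((apForm x y z - + ℕ.suc d) *_) (Σᴸ-τ-terms d))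

  degree-times : ∀ j {ts d} → All (λ t → degree t ℕ.≤ d) ts → All (λ t → degree t ℕ.≤ ℕ.suc d) (times j ts)
  degree-times j         []                             = []
  degree-times j {d = d} (_∷_ {term κ a b c} abc≤d ts≤d) =
    ℕ.s≤s abc≤d ∷
    subst (ℕ._≤ ℕ.suc d) (sym (lem₂ a b c)) (ℕ.s≤s abc≤d) ∷
    subst (ℕ._≤ ℕ.suc d) (sym (ℕ.+-suc (a ℕ.+ b) c)) (ℕ.s≤s abc≤d) ∷
    ℕ.m≤n⇒m≤1+n abc≤d ∷
    degree-times j ts≤d
    where
    lem₂ : ∀ a b c → a ℕ.+ ℕ.suc b ℕ.+ c ≡ ℕ.suc (a ℕ.+ b ℕ.+ c)
    lem₂ = ℕSolver.solve-∀

  degree-τ-terms : ∀ d → All (λ t → degree t ℕ.≤ d) (τ-terms d)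
  degree-τ-terms ℕ.zero    = ℕ.z≤n ∷ []
  degree-τ-terms (ℕ.suc d) = degree-times (ℕ.suc d) (degree-τ-terms d)

  monomial : ∀ {n} → Vec ℕ n → (Fin n → ℤ) → ℤ
  monomial α x = ∏ (λ k → x k ^ lookup α k)

  ∏-cong : ∀ {n} {f g : Fin n → ℤ} → (∀ k → f k ≡ g k) → ∏ f ≡ ∏ g
  ∏-cong {ℕ.zero}  eq = refl
  ∏-cong {ℕ.suc n} eq = cong₂ _*_ (eq zero) (∏-cong (eq ∘ suc))

  apTensor : ∀ d {n} → (x y z : Fin n → ℤ) → ℤ
  apTensor d x y z = ∏ (λ k → τ d (apForm (x k) (y k) (z k)))

  ∏-eval : ∀ {n} (w : Vec Term n) x y z →
           ∏ (λ k → eval (lookup w k) (x k) (y k) (z k)) ≡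
           ∏ (λ k → coeff (lookup w k)) * (monomial (Vec.map deg₁ w) x * (monomial (Vec.map deg₂ w) y * monomial (Vec.map deg₃ w) z))
  ∏-eval []      x y z = refl
  ∏-eval (term κ a b c ∷ w) x y z = trans
    (cong (eval (term κ a b c) (x zero) (y zero) (z zero) *_) (∏-eval w (x ∘ suc) (y ∘ suc) (z ∘ suc)))
    (lem κ (x zero ^ a) (y zero ^ b) (z zero ^ c) _ (monomial (Vec.map deg₁ w) (x ∘ suc)) (monomial (Vec.map deg₂ w) (y ∘ suc)) (monomial (Vec.map deg₃ w) (z ∘ suc)))
    where
    lem : ∀ κ a b c k l m n → κ * (a * (b * c)) * (k * (l * (m * n))) ≡ κ * k * (a * l * (b * m * (c * n)))
    lem = solve-∀

  apTensor-expansion : ∀ d {n} (x y z : Fin n → ℤ) → apTensor d x y z ≡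
    Σᴸ (words n (τ-terms d)) (λ w → ∏ (λ k → eval (lookup w k) (x k) (y k) (z k)))
  apTensor-expansion d x y z = sym (trans
    (Σᴸ-words (τ-terms d) (λ k t → eval t (x k) (y k) (z k)))
    (∏-cong (λ k → Σᴸ-τ-terms (x k) (y k) (z k) d)))

  module _ {d : ℕ} where

    degree-word : ∀ {n} {w : Vec Term n} → VecAll.All (λ t → degree t ℕ.≤ d) w →
                  Vec.sum (Vec.map deg₁ w) ℕ.+ Vec.sum (Vec.map deg₂ w) ℕ.+ Vec.sum (Vec.map deg₃ w) ℕ.≤ n ℕ.* d
    degree-word [] = ℕ.z≤n
    degree-word {ℕ.suc n} (_∷_ {x = term κ a b c} {xs = w} t≤d w≤d) = subst (ℕ._≤ ℕ.suc n ℕ.* d)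
      (lem a b c (Vec.sum (Vec.map deg₁ w)) (Vec.sum (Vec.map deg₂ w)) (Vec.sum (Vec.map deg₃ w)))
      (ℕ.+-mono-≤ t≤d (degree-word w≤d))
      where
      lem : ∀ a b c k l m → a ℕ.+ b ℕ.+ c ℕ.+ (k ℕ.+ l ℕ.+ m) ≡ a ℕ.+ k ℕ.+ (b ℕ.+ l) ℕ.+ (c ℕ.+ m)
      lem = ℕSolver.solve-∀

    ∈-exponents : ∀ {n} (e : Term → ℕ) → (∀ t → e t ℕ.≤ degree t) → {w : Vec Term n} →
                  VecAll.All (λ t → degree t ℕ.≤ d) w → Vec.map e w ∈ exponents d n
    ∈-exponents e e≤ = ∈-words⁺ ∘ go
      where
      go : ∀ {n} {w : Vec Term n} → VecAll.All (λ t → degree t ℕ.≤ d) w → VecAll.All (_∈ downFrom (ℕ.suc d)) (Vec.map e w)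
      go []            = []
      go (t≤d ∷ w≤d) = ∈-downFrom⁺ (ℕ.s≤s (ℕ.≤-trans (e≤ _) t≤d)) ∷ go w≤d

  some-third : ∀ a b c m → a ℕ.+ b ℕ.+ c ℕ.≤ m → 3 ℕ.* a ℕ.≤ m ⊎ 3 ℕ.* b ℕ.≤ m ⊎ 3 ℕ.* c ℕ.≤ m
  some-third a b c m a+b+c≤m with 3 ℕ.* a ℕ.≤? m | 3 ℕ.* b ℕ.≤? m | 3 ℕ.* c ℕ.≤? m
  ... | yes a≤ | _      | _      = inj₁ a≤
  ... | no  _  | yes b≤ | _      = inj₂ (inj₁ b≤)
  ... | no  _  | no  _  | yes c≤ = inj₂ (inj₂ c≤)
  ... | no  a≰ | no  b≰ | no  c≰ = contradiction (ℕ.*-monoʳ-≤ 3 a+b+c≤m) (ℕ.<⇒≱ (begin-strict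
    3 ℕ.* m                          ≡⟨ lem m ⟩
    m ℕ.+ m ℕ.+ m                    <⟨ ℕ.+-mono-< (ℕ.+-mono-< (ℕ.≰⇒> a≰) (ℕ.≰⇒> b≰)) (ℕ.≰⇒> c≰) ⟩
    3 ℕ.* a ℕ.+ 3 ℕ.* b ℕ.+ 3 ℕ.* c  ≡⟨ lem′ a b c ⟩
    3 ℕ.* (a ℕ.+ b ℕ.+ c)            ∎))
    where
    open ℕ.≤-Reasoning
    lem : ∀ m → 3 ℕ.* m ≡ m ℕ.+ m ℕ.+ m
    lem = ℕSolver.solve-∀
    lem′ : ∀ a b c → 3 ℕ.* a ℕ.+ 3 ℕ.* b ℕ.+ 3 ℕ.* c ≡ 3 ℕ.* (a ℕ.+ b ℕ.+ c)
    lem′ = ℕSolver.solve-∀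

  lowMonomials : ∀ d {n N} → (Fin N → Fin n → ℤ) → List (Fin N → ℤ)
  lowMonomials d {n} x = map (λ α i → monomial α (x i)) (lowExponents d n)

  module _ {p : ℕ} (prime : Prime p) where
    open ModPrime prime

    -- A word of terms gives a product tensor, and whichever of its three monomials has low degree
    -- pairs to 0 modulo `p` with the vector in that slot.
    apTensor-killed : ∀ d {n N} (x : Fin N → Fin n → ℤ) f g h →
      Annihilates f (lowMonomials d x) → Annihilates g (lowMonomials d x) → Annihilates h (lowMonomials d x) →
      p∣ contract f g h (λ i j k → apTensor d (x i) (x j) (x k))
    apTensor-killed d {n} {N} x f g h f⊥ g⊥ h⊥ = subst p∣_
      (sym (contract-cong f g h (λ i j k → apTensor-expansion d (x i) (x j) (x k))))
      (∣-contract-Σᴸ f g h (words n (τ-terms d)) _ (λ {w} w∈ → subst p∣_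
        (sym (trans (contract-cong f g h (λ i j k → ∏-eval w (x i) (x j) (x k))) (contract-rankOne f g h (∏ (λ k → coeff (lookup w k))) (value (Vec.map deg₁ w)) (value (Vec.map deg₂ w)) (value (Vec.map deg₃ w)))))
        (∣n⇒∣m*n (∏ (λ k → coeff (lookup w k))) (factor w (VecAll.map (All.lookup (degree-τ-terms d)) (∈-words⁻ n w∈))))))
      where
      value : Vec ℕ n → Fin N → ℤ
      value α i = monomial α (x i)
      low : ∀ u → Annihilates u (lowMonomials d x) → ∀ {α} → α ∈ exponents d n → 3 ℕ.* Vec.sum α ℕ.≤ n ℕ.* d → p∣ ⟨ u , value α ⟩
      low u u⊥ {α} α∈ α≤ = subst p∣_ (⟨,⟩-comm (value α) u)
        (All.lookup u⊥ (∈-map⁺ value (∈-filter⁺ (λ α → 3 ℕ.* Vec.sum α ℕ.≤? n ℕ.* d) α∈ α≤)))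
      factor : ∀ w → VecAll.All (λ t → degree t ℕ.≤ d) w →
        p∣ ⟨ f , value (Vec.map deg₁ w) ⟩ * (⟨ g , value (Vec.map deg₂ w) ⟩ * ⟨ h , value (Vec.map deg₃ w) ⟩)
      factor w w≤d with some-third (Vec.sum (Vec.map deg₁ w)) (Vec.sum (Vec.map deg₂ w)) (Vec.sum (Vec.map deg₃ w)) (n ℕ.* d) (degree-word w≤d)
      ... | inj₁ l        = ∣m⇒∣m*n (⟨ g , value (Vec.map deg₂ w) ⟩ * ⟨ h , value (Vec.map deg₃ w) ⟩) (low f f⊥ (∈-exponents deg₁ (λ t → ℕ.≤-trans (ℕ.m≤m+n (deg₁ t) (deg₂ t)) (ℕ.m≤m+n _ (deg₃ t))) w≤d) l)
      ... | inj₂ (inj₁ l) = ∣n⇒∣m*n ⟨ f , value (Vec.map deg₁ w) ⟩ (∣m⇒∣m*n ⟨ h , value (Vec.map deg₃ w) ⟩ (low g g⊥ (∈-exponents deg₂ (λ t → ℕ.≤-trans (ℕ.m≤n+m (deg₂ t) (deg₁ t)) (ℕ.m≤m+n _ (deg₃ t))) w≤d) l))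
      ... | inj₂ (inj₂ l) = ∣n⇒∣m*n ⟨ f , value (Vec.map deg₁ w) ⟩ (∣n⇒∣m*n ⟨ g , value (Vec.map deg₂ w) ⟩ (low h h⊥ (∈-exponents deg₃ (λ t → ℕ.m≤n+m (deg₃ t) (deg₁ t ℕ.+ deg₂ t)) w≤d) l))

-- From progression-free sets to diagonal tensors

module Progressions where
  open import Data.Bool.Base using (true; false)
  open import Data.Fin.Subset using (Subset) renaming (_∈_ to _∈ˢ_; ∣_∣ to card)
  open import Defs hiding (_^_)

  nth : ∀ {n} (S : Subset n) → Fin (card S) → Fin n
  nth (true  ∷ S) zero    = zero
  nth (true  ∷ S) (suc i) = suc (nth S i)
  nth (false ∷ S) i       = suc (nth S i)

  nth-∈ : ∀ {n} (S : Subset n) i → nth S i ∈ˢ S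
  nth-∈ (true  ∷ S) zero    = Vec.here
  nth-∈ (true  ∷ S) (suc i) = Vec.there (nth-∈ S i)
  nth-∈ (false ∷ S) i       = Vec.there (nth-∈ S i)

  nth-injective : ∀ {n} (S : Subset n) {i j} → nth S i ≡ nth S j → i ≡ j
  nth-injective (true  ∷ S) {zero}  {zero}  eq = refl
  nth-injective (true  ∷ S) {suc i} {suc j} eq = cong suc (nth-injective S (Fin.suc-injective eq))
  nth-injective (false ∷ S) eq = nth-injective S (Fin.suc-injective eq)

  module _ (G : FiniteAbelianGroup 0ℓ 0ℓ) where
    open FiniteAbelianGroup G renaming (sym to ≈-sym; trans to ≈-trans)

    point : (S : GSubset G) → Fin (card S) → Carrier
    point S i = element (nth S i)

    -- A zero difference h would make the three points equal, and `point` is injective. So distinct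
    -- indices force h to be nonzero and yield a forbidden progression.
    ap-trivial : ∀ S → APFree G S → ∀ i j k h →
                 point S j ≈ point S i + h → point S k ≈ point S i + (h + h) → j ≡ i × k ≡ i
    ap-trivial S free i j k h j≈ k≈ = decidable-stable ((j Fin.≟ i) ×-dec (k Fin.≟ i)) (λ nontrivial →
      free (point S i , h , h≉0 nontrivial , ∈S i ≈-refl , ∈S j j≈ , ∈S k k≈))
      where
      ≈-refl = FiniteAbelianGroup.refl G
      ∈S : ∀ l {a} → point S l ≈ a → index a ∈ˢ S
      ∈S l l≈a = subst (_∈ˢ S) (trans (sym (index-element (nth S l))) (index-cong l≈a)) (nth-∈ S l)
      injective : ∀ {l m} → point S l ≈ point S m → l ≡ m
      injective {l} {m} l≈m = nth-injective S
        (trans (sym (index-element (nth S l))) (trans (index-cong l≈m) (index-element (nth S m))))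
      absorb : ∀ {a b c} → a ≈ b + c → c ≈ 0# → a ≈ b
      absorb a≈b+c c≈0 = ≈-trans a≈b+c (≈-trans (+-cong ≈-refl c≈0) (identityʳ _))
      h≉0 : ¬ (j ≡ i × k ≡ i) → ¬ (h ≈ 0#)
      h≉0 nontrivial h≈0 = nontrivial
        (injective (absorb j≈ h≈0) , injective (absorb k≈ (≈-trans (+-cong h≈0 h≈0) (identityʳ 0#))))

  open Counting using (lowExponents)
  open SliceRank
  open import Data.Fin.Base using (toℕ)
  open import Data.Integer.Base hiding (suc; NonZero)
  open import Data.Integer.Properties using (+-*-semiring)
  open import Data.Integer.Divisibility.Signed
  open import Data.Integer.Tactic.RingSolver using (solve-∀)
  open WordSums +-*-semiring using (∏)

  module _ {d : ℕ} (prime : Prime (ℕ.suc d)) where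
    private
      p = ℕ.suc d
    open ModPrime prime

    τ-root : ∀ e {s j} → 1 ℕ.≤ j → j ℕ.≤ e → p∣ s - + j → p∣ τ e s
    τ-root ℕ.zero    1≤j j≤0 _ = contradiction (ℕ.≤-trans 1≤j j≤0) λ ()
    τ-root (ℕ.suc e) {s} {j} 1≤j j≤e p∣s-j with j ℕ.≟ ℕ.suc e
    ... | yes refl = ∣m⇒∣m*n (τ e s) p∣s-j
    ... | no  j≢e  = ∣n⇒∣m*n (s - + ℕ.suc e) (τ-root e 1≤j (ℕ.≤-pred (ℕ.≤∧≢⇒< j≤e j≢e)) p∣s-j)

    -- The residue of `s` is one of 1, ..., d, so one of the factors of `τ d s` is divisible by `p`.
    τ-zero : ∀ s → ¬ p∣ s → p∣ τ d s
    τ-zero s p∤s = τ-root d (ℕ.n≢0⇒n>0 r≢0) (ℕ.≤-pred (Fin.toℕ<n r)) (≡ₘ-sym p {+ toℕ r} {s} r≡s)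
      where
      r = residue p s
      r≡s = representative-residue p s
      lem : ∀ s → - (0ℤ - s) ≡ s
      lem = solve-∀
      r≢0 : toℕ r ≢ 0
      r≢0 eq = p∤s (subst p∣_ (lem s) (∣m⇒∣-m (subst (λ z → p∣ + z - s) eq r≡s)))

    -- At s ≡ 0 the factors are -1, ..., -e, and e < p keeps each of them prime to `p`.
    τ-unit : ∀ e {s} → e ℕ.< p → p∣ s → ¬ p∣ τ e s
    τ-unit ℕ.zero    _   _   = p∤1
    τ-unit (ℕ.suc e) {s} e<p p∣s = ∤-* {s - + ℕ.suc e} p∤s-e (τ-unit e (ℕ.<-trans (ℕ.n<1+n e) e<p) p∣s)
      where
      p∤s-e : ¬ p∣ s - + ℕ.suc e
      p∤s-e p∣s-e = ℕ.<⇒≱ e<p (ℕ.∣⇒≤ (∣⇒∣ᵤ (∣m+n∣m⇒∣n {m = s} {n = - + ℕ.suc e} p∣s-e p∣s)))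

    ∣-∏ : ∀ {n} {f : Fin n → ℤ} k → p∣ f k → p∣ ∏ f
    ∣-∏ {f = f} zero    p∣fk = ∣m⇒∣m*n (∏ (f ∘ suc)) p∣fk
    ∣-∏ {f = f} (suc k) p∣fk = ∣n⇒∣m*n (f zero) (∣-∏ {f = f ∘ suc} k p∣fk)

    ∤-∏ : ∀ {n} {f : Fin n → ℤ} → (∀ k → ¬ p∣ f k) → ¬ p∣ ∏ f
    ∤-∏ {ℕ.zero}  p∤f = p∤1
    ∤-∏ {ℕ.suc n} p∤f = ∤-* (p∤f zero) (∤-∏ (p∤f ∘ suc))

    apFree-bound : ∀ n S → APFree (ℤ/ (ℕ.suc d) {{prime⇒nonZero prime}} ^ᴳ n) S → card S ℕ.≤ 2 ℕ.* length (lowExponents d n)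
    apFree-bound n S S-free = subst (card S ℕ.≤_) (cong (2 ℕ.*_) (length-map _ (lowExponents d n)))
      (diagonal-bound prime (lowMonomials d x) (λ i j k → apTensor d (x i) (x j) (x k))
        (apTensor-killed prime d x) off diag)
      where
      G = ℤ/ (ℕ.suc d) {{prime⇒nonZero prime}} ^ᴳ n
      x : Fin (card S) → Fin n → ℤ
      x = point G S
      off : ∀ i j k → ¬ (j ≡ i × k ≡ i) → p∣ apTensor d (x i) (x j) (x k)
      -- Either some coordinate of xᵢ - 2xⱼ + xₖ is nonzero modulo `p`, and its factor of the tensor
      -- vanishes, or xᵢ, xⱼ, xₖ is a progression with difference xⱼ - xᵢ.
      off i j k ≢i with Fin.any? (λ m → ¬? (+ p ∣? apForm (x i m) (x j m) (x k m)))
      ... | yes (m , p∤) = ∣-∏ {f = λ m → τ d (apForm (x i m) (x j m) (x k m))} m (τ-zero _ p∤)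
      ... | no  none = contradiction (ap-trivial G S S-free i j k h second third) ≢i
        where
        h : Fin n → ℤ
        h m = x j m - x i m
        second : ∀ m → _≡ₘ_ p (x j m) (x i m + h m)
        second m = ≡⇒≡ₘ p (lem (x i m) (x j m))
          where
          lem : ∀ a b → b ≡ a + (b - a)
          lem = solve-∀
        third : ∀ m → _≡ₘ_ p (x k m) (x i m + (h m + h m))
        third m = subst p∣_ (lem (x i m) (x j m) (x k m))
          (decidable-stable (+ p ∣? apForm (x i m) (x j m) (x k m)) (λ p∤ → none (m , p∤)))
          where
          lem : ∀ a b c → a - + 2 * b + c ≡ c - (a + ((b - a) + (b - a)))
          lem = solve-∀
      diag : ∀ i → ¬ p∣ apTensor d (x i) (x i) (x i)
      diag i = ∤-∏ (λ m → τ-unit d (ℕ.n<1+n d) (subst p∣_ (sym (lem (x i m))) (divides 0ℤ refl)))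
        where
        lem : ∀ a → a - + 2 * a + a ≡ 0ℤ
        lem = solve-∀

    r₃-bound : ∀ n → r₃ (ℤ/ (ℕ.suc d) {{prime⇒nonZero prime}} ^ᴳ n) ℕ.≤ 2 ℕ.* length (lowExponents d n)
    r₃-bound n =
      let (S , S-free , card≡) = r₃-attained (ℤ/ (ℕ.suc d) {{prime⇒nonZero prime}} ^ᴳ n)
      in ℕ.≤-trans (ℕ.≤-reflexive (sym card≡)) (apFree-bound n S S-free)

-- From inequalities between natural numbers to real roots

module Roots where
  open import Algebra.Bundles using (CommutativeRing)
  open import Data.Integer.Base as ℤ using (+_)
  import Data.Integer.Properties as ℤ
  open import Data.Integer.Tactic.RingSolver using (solve-∀)
  open import Data.Rational.Base as ℚ using (0ℚ; toℚᵘ)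
  import Data.Rational.Properties as ℚ
  open import Algebra.Properties.CommutativeSemiring.Exp
    (CommutativeRing.commutativeSemiring ℚ.+-*-commutativeRing) using (^-distrib-*)
  open import Data.Rational.Unnormalised.Base as ℚᵘ using (mkℚᵘ; *≡*; *≤*; *<*)
  import Data.Rational.Unnormalised.Properties as ℚᵘ
  open import Defs

  -- A witness s of the lower class has sⁿ ≤ a ≤ cⁿ, which strict monotonicity of the power forbids
  -- when s > c.
  root≤fromℚ : ∀ n .{{_ : NonZero n}} a {c} → 0ℚ ℚ.≤ c → ℕ→ℚ a ℚ.≤ c ^ n → root n a ≤ℝ fromℚ c
  root≤fromℚ n a {c} 0≤c a≤cⁿ q (s , q<s , 0≤s , sⁿ≤a) with s ℚ.≤? c
  ... | yes s≤c = ℚ.<-≤-trans q<s s≤c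
  ... | no  s≰c = contradiction (ℚ.<-≤-trans (^-mono-< n 0≤c (ℚ.≰⇒> s≰c)) (ℚ.≤-trans sⁿ≤a a≤cⁿ)) (ℚ.<-irrefl refl)

  toℚᵘ-/ : ∀ i d .{{_ : NonZero d}} → toℚᵘ (i ℚ./ d) ℚᵘ.≃ i ℚᵘ./ d
  toℚᵘ-/ i (suc d) = ℚ.toℚᵘ-fromℚᵘ (mkℚᵘ i d)

  /*ℕ→ℚ : ∀ m d .{{_ : NonZero d}} → (+ m) ℚ./ d ℚ.* ℕ→ℚ d ≡ ℕ→ℚ m
  /*ℕ→ℚ m d@(suc _) = ℚ.toℚᵘ-injective (begin
    toℚᵘ ((+ m) ℚ./ d ℚ.* ℕ→ℚ d)             ≈⟨ ℚ.toℚᵘ-homo-* ((+ m) ℚ./ d) (ℕ→ℚ d) ⟩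
    toℚᵘ ((+ m) ℚ./ d) ℚᵘ.* toℚᵘ (ℕ→ℚ d)     ≈⟨ ℚᵘ.*-cong (toℚᵘ-/ (+ m) d) (toℚᵘ-/ (+ d) 1) ⟩
    (+ m) ℚᵘ./ d ℚᵘ.* ((+ d) ℚᵘ./ 1)         ≈⟨ *≡* (lem (+ m) (+ d)) ⟩
    (+ m) ℚᵘ./ 1                             ≈⟨ toℚᵘ-/ (+ m) 1 ⟨
    toℚᵘ (ℕ→ℚ m)                             ∎)
    where
    open ℚᵘ.≃-Reasoning
    lem : ∀ m d → (m ℤ.* d) ℤ.* (+ 1) ≡ m ℤ.* (d ℤ.* (+ 1))
    lem = solve-∀

  ℕ→ℚ-* : ∀ m n → ℕ→ℚ (m ℕ.* n) ≡ ℕ→ℚ m ℚ.* ℕ→ℚ n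
  ℕ→ℚ-* m n = ℚ.toℚᵘ-injective (begin
    toℚᵘ (ℕ→ℚ (m ℕ.* n))                     ≈⟨ toℚᵘ-/ (+ (m ℕ.* n)) 1 ⟩
    (+ (m ℕ.* n)) ℚᵘ./ 1                     ≈⟨ *≡* (cong (ℤ._* (+ 1)) (ℤ.pos-* m n)) ⟩
    (+ m) ℚᵘ./ 1 ℚᵘ.* ((+ n) ℚᵘ./ 1)         ≈⟨ ℚᵘ.*-cong (toℚᵘ-/ (+ m) 1) (toℚᵘ-/ (+ n) 1) ⟨
    toℚᵘ (ℕ→ℚ m) ℚᵘ.* toℚᵘ (ℕ→ℚ n)           ≈⟨ ℚ.toℚᵘ-homo-* (ℕ→ℚ m) (ℕ→ℚ n) ⟨
    toℚᵘ (ℕ→ℚ m ℚ.* ℕ→ℚ n)                   ∎)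
    where open ℚᵘ.≃-Reasoning

  ℕ→ℚ-mono-≤ : ∀ {m n} → m ℕ.≤ n → ℕ→ℚ m ℚ.≤ ℕ→ℚ n
  ℕ→ℚ-mono-≤ {m} {n} m≤n = ℚ.toℚᵘ-cancel-≤
    (ℚᵘ.≤-respˡ-≃ (ℚᵘ.≃-sym (toℚᵘ-/ (+ m) 1)) (ℚᵘ.≤-respʳ-≃ (ℚᵘ.≃-sym (toℚᵘ-/ (+ n) 1))
      (*≤* (ℤ.*-monoʳ-≤-nonNeg (+ 1) (ℤ.+≤+ m≤n)))))

  ℕ→ℚ-mono-< : ∀ {m n} → m ℕ.< n → ℕ→ℚ m ℚ.< ℕ→ℚ n
  ℕ→ℚ-mono-< {m} {n} m<n = ℚ.toℚᵘ-cancel-<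
    (ℚᵘ.<-respˡ-≃ (ℚᵘ.≃-sym (toℚᵘ-/ (+ m) 1)) (ℚᵘ.<-respʳ-≃ (ℚᵘ.≃-sym (toℚᵘ-/ (+ n) 1))
      (*<* (ℤ.*-monoʳ-<-pos (+ 1) (ℤ.+<+ m<n)))))

  ℕ→ℚ-^ : ∀ m n → ℕ→ℚ (m ℕ.^ n) ≡ ℕ→ℚ m ^ n
  ℕ→ℚ-^ m zero    = refl
  ℕ→ℚ-^ m (suc n) = trans (ℕ→ℚ-* m (m ℕ.^ n)) (cong (ℕ→ℚ m ℚ.*_) (ℕ→ℚ-^ m n))

  ℕ→ℚ-pos : ∀ k .{{_ : NonZero k}} → ℚ.Positive (ℕ→ℚ k)
  ℕ→ℚ-pos k = ℚ.normalize-pos k 1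

  module _ (m d : ℕ) .{{_ : NonZero d}} where

    ≤[m/d]^n : ∀ a n → a ℕ.* d ℕ.^ n ℕ.≤ m ℕ.^ n → ℕ→ℚ a ℚ.≤ ((+ m) ℚ./ d) ^ n
    ≤[m/d]^n a n h = ℚ.*-cancelʳ-≤-pos (ℕ→ℚ (d ℕ.^ n)) {{ℕ→ℚ-pos (d ℕ.^ n) {{ℕ.m^n≢0 d n}}}} (begin
      ℕ→ℚ a ℚ.* ℕ→ℚ (d ℕ.^ n)              ≡⟨ ℕ→ℚ-* a (d ℕ.^ n) ⟨
      ℕ→ℚ (a ℕ.* d ℕ.^ n)                  ≤⟨ ℕ→ℚ-mono-≤ h ⟩
      ℕ→ℚ (m ℕ.^ n)                        ≡⟨ ℕ→ℚ-^ m n ⟩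
      ℕ→ℚ m ^ n                            ≡⟨ cong (_^ n) (/*ℕ→ℚ m d) ⟨
      ((+ m) ℚ./ d ℚ.* ℕ→ℚ d) ^ n          ≡⟨ ^-distrib-* ((+ m) ℚ./ d) (ℕ→ℚ d) n ⟩
      ((+ m) ℚ./ d) ^ n ℚ.* ℕ→ℚ d ^ n      ≡⟨ cong (((+ m) ℚ./ d) ^ n ℚ.*_) (ℕ→ℚ-^ d n) ⟨
      ((+ m) ℚ./ d) ^ n ℚ.* ℕ→ℚ (d ℕ.^ n)  ∎)
      where open ℚ.≤-Reasoning

    m/d<p : ∀ p → m ℕ.< p ℕ.* d → (+ m) ℚ./ d ℚ.< ℕ→ℚ p
    m/d<p p m<pd = ℚ.*-cancelʳ-<-nonNeg (ℕ→ℚ d) {{ℚ.nonNegative (0≤ℕ→ℚ d)}}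
      (subst₂ ℚ._<_ (sym (/*ℕ→ℚ m d)) (ℕ→ℚ-* p d) (ℕ→ℚ-mono-< m<pd))

    0≤m/d : 0ℚ ℚ.≤ (+ m) ℚ./ d
    0≤m/d = ℚ.nonNegative⁻¹ _ {{ℚ.normalize-nonNeg m d}}

  roots-bounded-away : ∀ {p} m d .{{_ : NonZero d}} → m ℕ.< p ℕ.* d → ∀ n₀ (a : ℕ → ℕ) →
    (∀ n → n₀ ℕ.≤ n → a n ℕ.* d ℕ.^ n ℕ.≤ m ℕ.^ n) →
    Σ[ c ∈ ℝ ] (c <ℝ fromℕ p × (∃[ n₀ ] ∀ n .{{_ : NonZero n}} → n₀ ℕ.≤ n → root n (a n) ≤ℝ c))
  -- The order `_<ℝ_` asks for a rational strictly between c and p, which density supplies.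
  roots-bounded-away {p} m d m<pd n₀ a a≤ = fromℚ (+ m ℚ./ d) , ℚ.<-dense (m/d<p m d p m<pd) , n₀ ,
    λ n n₀≤n → root≤fromℚ n (a n) {+ m ℚ./ d} (0≤m/d m d) (≤[m/d]^n m d (a n) n (a≤ n n₀≤n))

-- The bound for an odd prime

open import Defs
open import Data.Nat using (ℕ; NonZero; _≤_)
open import Data.Nat.Divisibility using (_∤_)
open import Data.Product using (Σ; Σ-syntax; ∃-syntax; _×_)
open Counting using (X; Y; 2Y≢0; X+Y<2Y; lowExponents-bound)
open Progressions using (r₃-bound)
open Roots using (roots-bounded-away)

-- The constants are c = p(X + Y)/(2Y), which lies below p because X < Y, and n₀ = 2X. Writing p as
-- `suc d` exposes the degree d.
mainTheorem2-suc : ∀ d .{{_ : NonZero d}} (prime : Prime (suc d)) →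
    Σ[ c ∈ ℝ ] (c <ℝ fromℕ (suc d) × (∃[ n₀ ] ∀ n .{{_ : NonZero n}} → n₀ ≤ n →
    root n (r₃ (ℤ/ (suc d) {{prime⇒nonZero prime}} ^ᴳ n)) ≤ℝ c))
mainTheorem2-suc d pr = roots-bounded-away {suc d} (suc d ℕ.* (X d ℕ.+ Y d)) (2 ℕ.* Y d) {{2Y≢0 d}}
  (ℕ.*-monoʳ-< (suc d) (X+Y<2Y d)) (2 ℕ.* X d) (λ n → r₃ (ℤ/ (suc d) {{prime⇒nonZero pr}} ^ᴳ n))
  (λ n n₀≤n → lowExponents-bound d n (r₃ (ℤ/ (suc d) {{prime⇒nonZero pr}} ^ᴳ n)) n₀≤n (r₃-bound {d} pr n))

mainTheorem2 : ∀ p (prime : Prime p) → 2 ∤ p →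
    Σ[ c ∈ ℝ ] (c <ℝ fromℕ p × (∃[ n₀ ] ∀ n .{{_ : NonZero n}} → n₀ ≤ n →
    root n (r₃ (ℤ/ p {{prime⇒nonZero prime}} ^ᴳ n)) ≤ℝ c))
mainTheorem2 0               pr _ = contradiction pr ¬prime[0]
mainTheorem2 1               pr _ = contradiction pr ¬prime[1]
mainTheorem2 (suc d@(suc _)) pr _ = mainTheorem2-suc d pr
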